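{- There is an algorithm which, given a semilinear equivariant deterministic finite automaton with the integer atoms, computes the minimal deterministic automaton recognizing the same language.
   Context: Integer atoms: the atoms are the integers $\mathbb{Z}$ with the successor function; the automorphisms of atoms are exactly the translations $\pi_z : x \mapsto x+z$ ($z \in \mathbb{Z}$). An automorphism $\pi$ acts on sets built from atoms (tuples, sets of atoms, sets of sets, ...) by applying it to every atom occurring hereditarily; the result is written $x\cdot\pi$. A set, relation or function is equivariant if it is invariant under every translation (for a function: $f(x\cdot\pi)=f(x)\cdot\pi$). The orbit of $x$ is $\{x\cdot \pi : \pi \text{ a translation}\}$; an equivariant set is orbit-finite if it is a finite union of orbits, and single-orbit if it is one orbit. For $k\ge 1$, $\mathbb{Z}_k$ denotes the integers modulo $k$ with translations acting by addition, and $\mathbb{Z}_0=\mathbb{Z}$; every equivariant single-orbit set is equivariantly isomorphic to $\mathbb{Z}_k$ for a unique $k\in\mathbb{N}$ (its characteristic). Polynomial and semilinear sets: a monomial set is a finite Cartesian product of equivariant single-orbit sets; a polynomial set is a finite disjoint union of monomial sets. A subset of $\mathbb{Z}^m$ is semilinear in the usual sense (definable in Presburger arithmetic); every subset of $\mathbb{Z}_k$, $k\ge 1$, is semilinear. A product $\mathbb{Z}_{k_1}\times\cdots\times\mathbb{Z}_{k_n}$ is equivariantly isomorphic to a finite disjoint union of monomials of the form $\mathbb{Z}^m$ or $\mathbb{Z}_k$ (using $\mathbb{Z}_k\times\mathbb{Z}\cong$ disjoint union of $k$ copies of $\mathbb{Z}$ and $\mathbb{Z}_k\times\mathbb{Z}_l\cong\mathbb{Z}_{\mathrm{lcm}(k,l)}$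 for $k,l\ge1$); a subset is semilinear if its image under this isomorphism is semilinear on each component (independent of the choice of isomorphism). A subset of a monomial $X_1\times\cdots\times X_n$ is semilinear if its image under some tuple of equivariant isomorphisms $X_i\to\mathbb{Z}_{k_i}$ is semilinear, and a subset of a polynomial set is semilinear if its part in each monomial is. A relation or function between polynomial sets is semilinear if its graph is. Automata: a deterministic finite automaton (DFA) with atoms consists of an orbit-finite equivariant input alphabet $A$, an orbit-finite equivariant state set $Q$, a transition function $\delta: Q\times A\to Q$, an initial state and a set $F\subseteq Q$ of accepting states. It is equivariant if $\delta$, the initial state and $F$ are equivariant, and semilinear if $\delta$ (as a subset of the polynomial set $Q\times A\times Q$) is semilinear. Automata are given to algorithms by listing the characteristics of the orbits of $A$ and $Q$ and giving the semilinear transition relation by Presburger descriptions on each monomial. The minimal automaton is the Myhill–Nerode (syntactic) automaton of the recognized language. -}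

module Defs where

open import Data.Nat as ℕ using (ℕ; zero; suc)
open import Data.Integer as ℤ using (ℤ; +_; _%ℕ_)
open import Data.Integer.DivMod using (n%ℕd<d)
open import Data.Fin as Fin using (Fin; toℕ; fromℕ<)
open import Data.List as List using (List; []; _∷_; length; lookup; _++_)
open import Data.Bool using (Bool; true; false)
open import Data.Product using (Σ; ∃; _×_; _,_; proj₁; proj₂)
open import Data.Sum using (_⊎_)
open import Data.Empty using (⊥)
open import Data.Unit using (⊤)
open import Relation.Binary.PropositionalEquality using (_≡_)

-- Single-orbit sets ℤ_k (ℤ_0 = ℤ, ℤ_k = ℤ mod k, elements as Fin k)

Zk : ℕ → Set
Zk zero    = ℤ
Zk (suc k) = Fin (suc k)

act : (k : ℕ) → ℤ → Zk k → Zk k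
act zero    z x = x ℤ.+ z
act (suc k) z x = fromℕ< (n%ℕd<d (+ toℕ x ℤ.+ z) (suc k))

rep : (k : ℕ) → Zk k → ℤ
rep zero    x = x
rep (suc k) x = + toℕ x

-- Orbit-finite equivariant sets, given by the list of characteristics
-- of their orbits: an element is an orbit index together with an
-- element of the corresponding ℤ_k.

Elt : List ℕ → Set
Elt ks = Σ (Fin (length ks)) λ i → Zk (lookup ks i)

orbit : ∀ ks → Elt ks → Fin (length ks)
orbit ks = proj₁

actE : ∀ ks → ℤ → Elt ks → Elt ks
actE ks z (i , x) = i , act (lookup ks i) z x

repE : ∀ ks → Elt ks → ℤ
repE ks (i , x) = rep (lookup ks i) x

data Term (n : ℕ) : Set where
  var  : Fin n → Term n
  con  : ℤ → Term n
  _⊕_  : Term n → Term n → Term n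
  _⊛_  : ℤ → Term n → Term n

data Formula (n : ℕ) : Set where
  tt ff   : Formula n
  _≤′_    : Term n → Term n → Formula n
  _≐′_    : Term n → Term n → Formula n
  _∣′_    : ℕ → Term n → Formula n
  ¬′_     : Formula n → Formula n
  _∧′_    : Formula n → Formula n → Formula n
  _∨′_    : Formula n → Formula n → Formula n
  ∃′ ∀′   : Formula (suc n) → Formula n

Env : ℕ → Set
Env n = Fin n → ℤ

extend : ∀ {n} → ℤ → Env n → Env (suc n)
extend x ρ Fin.zero    = x
extend x ρ (Fin.suc i) = ρ i

⟦_⟧t : ∀ {n} → Term n → Env n → ℤ
⟦ var i ⟧t ρ = ρ i
⟦ con c ⟧t ρ = c
⟦ s ⊕ t ⟧t ρ = ⟦ s ⟧t ρ ℤ.+ ⟦ t ⟧t ρ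
⟦ c ⊛ t ⟧t ρ = c ℤ.* ⟦ t ⟧t ρ

⟦_⟧ : ∀ {n} → Formula n → Env n → Set
⟦ tt ⟧      ρ = ⊤
⟦ ff ⟧      ρ = ⊥
⟦ s ≤′ t ⟧  ρ = ⟦ s ⟧t ρ ℤ.≤ ⟦ t ⟧t ρ
⟦ s ≐′ t ⟧  ρ = ⟦ s ⟧t ρ ≡ ⟦ t ⟧t ρ
⟦ d ∣′ t ⟧  ρ = Σ ℤ λ m → ⟦ t ⟧t ρ ≡ m ℤ.* + d
⟦ ¬′ φ ⟧    ρ = ⟦ φ ⟧ ρ → ⊥
⟦ φ ∧′ ψ ⟧  ρ = ⟦ φ ⟧ ρ × ⟦ ψ ⟧ ρ
⟦ φ ∨′ ψ ⟧  ρ = ⟦ φ ⟧ ρ ⊎ ⟦ ψ ⟧ ρ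
⟦ ∃′ φ ⟧    ρ = Σ ℤ λ x → ⟦ φ ⟧ (extend x ρ)
⟦ ∀′ φ ⟧    ρ = (x : ℤ) → ⟦ φ ⟧ (extend x ρ)

env3 : ℤ → ℤ → ℤ → Env 3
env3 a b c Fin.zero = a
env3 a b c (Fin.suc Fin.zero) = b
env3 a b c (Fin.suc (Fin.suc Fin.zero)) = c

-- Descriptions of semilinear DFAs with integer atoms over the
-- orbit-finite alphabet with orbit characteristics A.
-- For each monomial Q_i × A_j × Q_l of Q × A × Q the transition
-- relation is given by a Presburger formula with 3 free variables
-- (state, letter, target), read on canonical representatives.
-- The equivariant set F of accepting states is a union of orbits.

record Desc (A : List ℕ) : Set where
  field
    states : List ℕ
    trans  : Fin (length states) → Fin (length A) → Fin (length states) → Formula 3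
    init   : Elt states
    final  : Fin (length states) → Bool

module _ {A : List ℕ} (D : Desc A) where
  open Desc D

  State : Set
  State = Elt states

  Letter : Set
  Letter = Elt A

  Word : Set
  Word = List Letter

  Δ : State → Letter → State → Set
  Δ q a q′ = ⟦ trans (orbit states q) (orbit A a) (orbit states q′) ⟧ (env3 (repE states q) (repE A a) (repE states q′))

  Accepting : State → Set
  Accepting q = final (orbit states q) ≡ true

  record IsEquivariantDFA : Set where
    field
      total      : ∀ q a → Σ State λ q′ → Δ q a q′
      functional : ∀ q a q′ q″ → Δ q a q′ → Δ q a q″ → q′ ≡ q″
      δ-equiv    : ∀ (z : ℤ) q a q′ → Δ q a q′ → Δ (actE states z q) (actE A z a) (actE states z q′)
      init-equiv : ∀ (z : ℤ) → actE states z init ≡ init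

  data Run : State → Word → State → Set where
    done : ∀ {q} → Run q [] q
    step : ∀ {q a q′ w q″} → Δ q a q′ → Run q′ w q″ → Run q (a ∷ w) q″

  LangFrom : State → Word → Set
  LangFrom q w = Σ State λ q′ → Run q w q′ × Accepting q′

  Lang : Word → Set
  Lang = LangFrom init

  Residual : Word → Word → Set
  Residual u v = Lang (u ++ v)

  -- the automaton is (isomorphic to) the Myhill–Nerode automaton:
  -- the map q ↦ LangFrom q is a bijection from the states onto the
  -- residuals {u⁻¹L} (up to extensional equality of languages).
  -- It automatically sends init to L, commutes with transitions
  -- (a⁻¹ on residuals) and reflects acceptance (ε ∈ residual).
  record IsMinimal : Set where
    field
      into   : ∀ q → Σ Word λ u → ∀ v → (LangFrom q v → Residual u v) × (Residual u v → LangFrom q v)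
      onto   : ∀ u → Σ State λ q → ∀ v → (LangFrom q v → Residual u v) × (Residual u v → LangFrom q v)
      inj    : ∀ q q′ → (∀ v → (LangFrom q v → LangFrom q′ v) × (LangFrom q′ v → LangFrom q v)) → q ≡ q′

{-# OPTIONS --safe #-}

-- Presburger formulas are decided by quantifier elimination, so all first-order questions about D are
-- decidable. Moore's partition refinement need not terminate here (δ may halve distances between states),
-- so the Nerode equivalence ~ is computed differently: once a bound C on its finite periods is known, it is
-- one of the relations E given by offsets σ_il ∈ ℤ and moduli g_il ≤ C through
-- "(i , x) E (l , y) iff g_il ∣ y − x − σ_il", and it is the largest bisimulation of this form, where
-- "E is a bisimulation" is a Presburger property of the parameters σ and g.
--
-- For the bound, QE shows that the target of δ is eventually affine along multiples of a fixed P. So if q has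
-- a nonzero period, then q · Pu and q read a letter into states that differ by cu, for some c.
-- Hence z is a period of q as soon as it stays divisible by P (modulo periods) under all iterates of the maps
-- Pu ↦ cu, and P^(k+1) stays so for k steps. For k the number of orbits this suffices: along a cycle through an
-- orbit the order of the displacement in the cyclic group ℤ / periods can only drop, so the later displacement is a
-- multiple of the earlier one.
module Submission where

open import Defs
open import Data.Bool using (Bool; true; false)
import Data.Bool.Properties as Boolₚ
open import Data.Nat as ℕ using (ℕ; zero; suc)
import Data.Nat.Properties as ℕₚ
import Data.Nat.Divisibility as ℕᵈ
open import Data.Nat.Induction using (<-rec)
open import Data.Nat.ListAction using (product)
open import Data.Nat.ListAction.Properties using (∈⇒∣product; product≢0)
open import Data.Integer as ℤ using (ℤ; +_; -[1+_]; ∣_∣; 0ℤ; _%ℕ_; _/ℕ_)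
import Data.Integer.Properties as ℤₚ
open import Data.Integer.DivMod using (n%ℕd<d; a≡a%ℕn+[a/ℕn]*n)
open import Data.Integer.Divisibility.Signed
open import Data.Integer.Tactic.RingSolver using (solve-∀)
open import Data.Fin as Fin using (Fin; toℕ; fromℕ<; splitAt; combine; remQuot; _↑ˡ_; _↑ʳ_)
import Data.Fin.Properties as Finₚ
open import Data.List as List using (List; []; _∷_; _++_; length; lookup; tabulate; allFin; upTo; concatMap)
import Data.List.Properties as Listₚ
open import Data.List.Relation.Unary.Any as Any using (Any; here; there)
import Data.List.Relation.Unary.Any.Properties as Anyₚ
open import Data.List.Relation.Unary.All as All using (All; []; _∷_)
import Data.List.Relation.Unary.All.Properties as Allₚ
open import Data.List.Membership.Propositional using (_∈_; lose)
open import Data.List.Membership.Propositional.Properties using (∈-upTo⁺; ∈-tabulate⁺; ∈-allFin)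
open import Data.Product using (Σ; _×_; _,_; proj₁; proj₂)
open import Data.Sum using (_⊎_; inj₁; inj₂; [_,_]′)
open import Data.Unit using (⊤; tt)
open import Data.Empty using (⊥; ⊥-elim)
open import Function using (_∘_; id)
open import Relation.Nullary using (¬_; Dec; yes; no; contradiction)
open import Relation.Nullary.Decidable using (¬?; _×-dec_; _⊎-dec_; map′; decidable-stable; ¬¬-excluded-middle)
open import Relation.Binary.PropositionalEquality

-- Quantifier elimination

-- Whether an orbit has a nonzero period, or whether two orbits merge, involves all words and is not
-- decidable in advance, so the largest bisimulation of the given form cannot simply be written
-- down. Only its existence up to double negation is available. That suffices: `decMerge` asks
-- whether some parameter vector is a bisimulation relating two given points, which elimination
-- decides, and the double-negated existence rules out a wrong negative answer. For this not to be
-- circular, `C` must not refer to periods: it is P^(n+1) for n orbits, where P is computed from the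
-- letter characteristics and the moduli in the formulas that elimination produces. Orbits without a
-- nonzero period have modulus 0 and satisfy the bound trivially.

infix 1 _⟺_
_⟺_ : Set → Set → Set
A ⟺ B = (A → B) × (B → A)

⟺-refl : ∀ {A} → A ⟺ A
⟺-refl = id , id

⟺-sym : ∀ {A B} → A ⟺ B → B ⟺ A
⟺-sym (f , g) = g , f

⟺-trans : ∀ {A B C} → A ⟺ B → B ⟺ C → A ⟺ C
⟺-trans (f , g) (h , k) = h ∘ f , g ∘ k

-- Quantifier-free Presburger formulas: t ≤ 0, (d + 1) ∣ t and Boolean combinations.
data QF (n : ℕ) : Set where
  le    : Term n → QF n
  dv    : ℕ → Term n → QF n
  no′   : QF n → QF n
  an or : QF n → QF n → QF n

Sat : ∀ {n} → QF n → Env n → Set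
Sat (le t)   ρ = ⟦ t ⟧t ρ ℤ.≤ 0ℤ
Sat (dv d t) ρ = + suc d ∣ ⟦ t ⟧t ρ
Sat (no′ φ)  ρ = ¬ Sat φ ρ
Sat (an φ ψ) ρ = Sat φ ρ × Sat ψ ρ
Sat (or φ ψ) ρ = Sat φ ρ ⊎ Sat ψ ρ

sat? : ∀ {n} (φ : QF n) ρ → Dec (Sat φ ρ)
sat? (le t)   ρ = ⟦ t ⟧t ρ ℤ.≤? 0ℤ
sat? (dv d t) ρ = + suc d ∣? ⟦ t ⟧t ρ
sat? (no′ φ)  ρ = ¬? (sat? φ ρ)
sat? (an φ ψ) ρ = sat? φ ρ ×-dec sat? ψ ρ
sat? (or φ ψ) ρ = sat? φ ρ ⊎-dec sat? ψ ρ

¬-cong : ∀ {A B : Set} → A ⟺ B → ¬ A ⟺ ¬ B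
¬-cong (f , g) = (_∘ g) , (_∘ f)

×-cong : ∀ {A B C D : Set} → A ⟺ B → C ⟺ D → (A × C) ⟺ (B × D)
×-cong (f , g) (h , k) = (λ (a , c) → f a , h c) , (λ (a , c) → g a , k c)

⊎-cong : ∀ {A B C D : Set} → A ⟺ B → C ⟺ D → (A ⊎ C) ⟺ (B ⊎ D)
⊎-cong (f , g) (h , k) = [ inj₁ ∘ f , inj₂ ∘ h ]′ , [ inj₁ ∘ g , inj₂ ∘ k ]′

coef : ∀ {n} → Term (suc n) → ℤ
coef (var Fin.zero)    = + 1
coef (var (Fin.suc i)) = + 0
coef (con c)           = + 0
coef (s ⊕ t)           = coef s ℤ.+ coef t
coef (c ⊛ t)           = c ℤ.* coef t

rest : ∀ {n} → Term (suc n) → Term n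
rest (var Fin.zero)    = con (+ 0)
rest (var (Fin.suc i)) = var i
rest (con c)           = con c
rest (s ⊕ t)           = rest s ⊕ rest t
rest (c ⊛ t)           = c ⊛ rest t

term-split : ∀ {n} (t : Term (suc n)) ρ →
  ⟦ t ⟧t ρ ≡ coef t ℤ.* ρ Fin.zero ℤ.+ ⟦ rest t ⟧t (ρ ∘ Fin.suc)
term-split (var Fin.zero)    ρ = lem (ρ Fin.zero)
  where lem : ∀ x → x ≡ + 1 ℤ.* x ℤ.+ + 0
        lem = solve-∀
term-split (var (Fin.suc i)) ρ = sym (ℤₚ.+-identityˡ _)
term-split (con c)           ρ = sym (ℤₚ.+-identityˡ _)
term-split (s ⊕ t)           ρ = trans (cong₂ ℤ._+_ (term-split s ρ) (term-split t ρ)) (lem (coef s) (coef t) (ρ Fin.zero) _ _)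
  where lem : ∀ a b x u v → (a ℤ.* x ℤ.+ u) ℤ.+ (b ℤ.* x ℤ.+ v) ≡ (a ℤ.+ b) ℤ.* x ℤ.+ (u ℤ.+ v)
        lem = solve-∀
term-split (c ⊛ t)           ρ = trans (cong (c ℤ.*_) (term-split t ρ)) (lem c (coef t) (ρ Fin.zero) _)
  where lem : ∀ c a x u → c ℤ.* (a ℤ.* x ℤ.+ u) ≡ c ℤ.* a ℤ.* x ℤ.+ c ℤ.* u
        lem = solve-∀

period : ∀ {n} → QF n → ℕ
period (le t)   = 1
period (dv d t) = suc d
period (no′ φ)  = period φ
period (an φ ψ) = period φ ℕ.* period ψ
period (or φ ψ) = period φ ℕ.* period ψ

period≢0 : ∀ {n} (φ : QF n) → ℕ.NonZero (period φ)
period≢0 (le t)   = _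
period≢0 (dv d t) = _
period≢0 (no′ φ)  = period≢0 φ
period≢0 (an φ ψ) = ℕₚ.m*n≢0 _ _ {{period≢0 φ}} {{period≢0 ψ}}
period≢0 (or φ ψ) = ℕₚ.m*n≢0 _ _ {{period≢0 φ}} {{period≢0 ψ}}

-- (k , t) stands for the bound (k + 1) x + t ≶ 0 on the eliminated variable x.
bound : ∀ {n} → ℤ → Term n → List (ℕ × Term n)
bound (+ 0)     t = []
bound (+ suc k) t = (k , t) ∷ []
bound -[1+ k ]  t = (k , (ℤ.- + 1) ⊛ t) ∷ []

bounds : ∀ {n} → QF (suc n) → List (ℕ × Term n)
bounds (le t)   = bound (coef t) (rest t)
bounds (dv d t) = []
bounds (no′ φ)  = bounds φ
bounds (an φ ψ) = bounds φ ++ bounds ψ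
bounds (or φ ψ) = bounds φ ++ bounds ψ

-- Strictness excludes `a = 0`, and a summand of smaller absolute value cannot change the sign of a
-- nonzero `a`.
sign-stable : ∀ a b → ∣ b ∣ ℕ.< ∣ a ∣ → (a ℤ.≤ 0ℤ) ⟺ (a ℤ.+ b ℤ.≤ 0ℤ)
sign-stable (+ suc m) (+ n) b<a = (λ { (ℤ.+≤+ ()) }) , (λ { (ℤ.+≤+ ()) })
sign-stable (+ suc m) -[1+ n ] (ℕ.s≤s n<m) = (λ { (ℤ.+≤+ ()) }) , λ p → ⊥-elim (lem p)
  where
  lem : ¬ (suc m ℤ.⊖ suc n ℤ.≤ 0ℤ)
  lem p rewrite ℤₚ.[1+m]⊖[1+n]≡m⊖n m n | ℤₚ.⊖-≥ (ℕₚ.<⇒≤ n<m) =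
    ℕₚ.<⇒≱ (ℕₚ.m<n⇒0<n∸m n<m) (ℤₚ.drop‿+≤+ p)
sign-stable -[1+ m ] -[1+ n ] b<a = (λ _ → ℤ.-≤+) , (λ _ → ℤ.-≤+)
sign-stable -[1+ m ] (+ n) b<a = (λ _ → lem) , (λ _ → ℤ.-≤+)
  where
  lem : n ℤ.⊖ suc m ℤ.≤ 0ℤ
  lem rewrite ℤₚ.⊖-< b<a = ℤₚ.neg-mono-≤ (ℤ.+≤+ (ℕ.z≤n {suc m ℕ.∸ n}))

Value : ∀ {n} → Env n → ℤ → ℕ × Term n → ℤ
Value ρ x (k , t) = + suc k ℤ.* x ℤ.+ ⟦ t ⟧t ρ

-- Shifting `x` by at most `D` changes the value by at most `suc k * D`, so such a shift does not
-- cross a far bound.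
Far : ∀ {n} → Env n → ℕ → ℤ → ℕ × Term n → Set
Far ρ D x b = suc (proj₁ b) ℕ.* D ℕ.< ∣ Value ρ x b ∣

far? : ∀ {n} (ρ : Env n) D x b → Dec (Far ρ D x b)
far? ρ D x b = _ ℕ.<? _

private
  ≤0-resp : ∀ {a b} → a ≡ b → (a ℤ.≤ 0ℤ) ⟺ (b ℤ.≤ 0ℤ)
  ≤0-resp refl = ⟺-refl

  bound-invariant : ∀ {n} (ρ : Env n) x e c t →
    All (Far ρ ∣ e ∣ x) (bound c t) →
    (c ℤ.* x ℤ.+ ⟦ t ⟧t ρ ℤ.≤ 0ℤ) ⟺ (c ℤ.* (x ℤ.+ e) ℤ.+ ⟦ t ⟧t ρ ℤ.≤ 0ℤ)
  bound-invariant ρ x e (+ 0) t _ = ⟺-refl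
  bound-invariant ρ x e (+ suc k) t (far ∷ []) =
    ⟺-trans (sign-stable _ (+ suc k ℤ.* e) (subst (ℕ._< _) (sym (ℤₚ.abs-* (+ suc k) e)) far))
            (≤0-resp (lem (+ suc k) x e (⟦ t ⟧t ρ)))
    where lem : ∀ c x e t → c ℤ.* x ℤ.+ t ℤ.+ c ℤ.* e ≡ c ℤ.* (x ℤ.+ e) ℤ.+ t
          lem = solve-∀
  bound-invariant ρ x e -[1+ k ] t (far ∷ []) =
    ⟺-trans (sign-stable _ (-[1+ k ] ℤ.* e) (subst₂ ℕ._<_ (sym (ℤₚ.abs-* -[1+ k ] e)) eq far))
            (≤0-resp (lem -[1+ k ] x e (⟦ t ⟧t ρ)))
    where lem : ∀ c x e t → c ℤ.* x ℤ.+ t ℤ.+ c ℤ.* e ≡ c ℤ.* (x ℤ.+ e) ℤ.+ t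
          lem = solve-∀
          neg : ∀ c x t → c ℤ.* x ℤ.+ (ℤ.- + 1) ℤ.* t ≡ ℤ.- ((ℤ.- c) ℤ.* x ℤ.+ t)
          neg = solve-∀
          eq : ∣ + suc k ℤ.* x ℤ.+ (ℤ.- + 1) ℤ.* ⟦ t ⟧t ρ ∣ ≡ ∣ -[1+ k ] ℤ.* x ℤ.+ ⟦ t ⟧t ρ ∣
          eq = trans (cong ∣_∣ (neg (+ suc k) x (⟦ t ⟧t ρ))) (ℤₚ.∣-i∣≡∣i∣ (-[1+ k ] ℤ.* x ℤ.+ ⟦ t ⟧t ρ))

shift-divides : ∀ {d} c x e t → d ∣ e → (d ∣ c ℤ.* x ℤ.+ t) ⟺ (d ∣ c ℤ.* (x ℤ.+ e) ℤ.+ t)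
shift-divides {d} c x e t d∣e =
  (λ p → subst (d ∣_) (lem c x e t) (∣m∣n⇒∣m+n p (∣n⇒∣m*n c d∣e))) ,
  (λ p → ∣m+n∣n⇒∣m (subst (d ∣_) (sym (lem c x e t)) p) (∣n⇒∣m*n c d∣e))
  where lem : ∀ c x e t → c ℤ.* x ℤ.+ t ℤ.+ c ℤ.* e ≡ c ℤ.* (x ℤ.+ e) ℤ.+ t
        lem = solve-∀

m∣mn : ∀ m n → + m ∣ + (m ℕ.* n)
m∣mn m n = divides (+ n) (trans (ℤₚ.pos-* m n) (ℤₚ.*-comm (+ m) (+ n)))

n∣mn : ∀ m n → + n ∣ + (m ℕ.* n)
n∣mn m n = divides (+ m) (ℤₚ.pos-* m n)

-- Far bounds preserve the truth of each `le`, divisibility of `e` that of each `dv`. Every atom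
-- keeps its truth value in both directions, so negation calls for no normal form.
shift-invariant : ∀ {n} (φ : QF (suc n)) ρ x e → + period φ ∣ e → All (Far ρ ∣ e ∣ x) (bounds φ) →
  Sat φ (extend x ρ) ⟺ Sat φ (extend (x ℤ.+ e) ρ)
shift-invariant (le t) ρ x e p far =
  ⟺-trans (≤0-resp (term-split t (extend x ρ)))
    (⟺-trans (bound-invariant ρ x e (coef t) (rest t) far) (≤0-resp (sym (term-split t (extend (x ℤ.+ e) ρ)))))
shift-invariant (dv d t) ρ x e p far =
  subst₂ (λ a b → (_ ∣ a) ⟺ (_ ∣ b)) (sym (term-split t (extend x ρ))) (sym (term-split t (extend (x ℤ.+ e) ρ)))
    (shift-divides (coef t) x e (⟦ rest t ⟧t ρ) p)
shift-invariant (no′ φ) ρ x e p far = ¬-cong (shift-invariant φ ρ x e p far)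
shift-invariant (an φ ψ) ρ x e p far = ×-cong
  (shift-invariant φ ρ x e (∣-trans (m∣mn (period φ) (period ψ)) p) (Allₚ.++⁻ˡ (bounds φ) far))
  (shift-invariant ψ ρ x e (∣-trans (n∣mn (period φ) (period ψ)) p) (Allₚ.++⁻ʳ (bounds φ) far))
shift-invariant (or φ ψ) ρ x e p far = ⊎-cong
  (shift-invariant φ ρ x e (∣-trans (m∣mn (period φ) (period ψ)) p) (Allₚ.++⁻ˡ (bounds φ) far))
  (shift-invariant ψ ρ x e (∣-trans (n∣mn (period φ) (period ψ)) p) (Allₚ.++⁻ʳ (bounds φ) far))

-- A candidate (k , T) proposes the value x = T / (k + 1).
Solves : ∀ {n} → Env n → ℤ → ℕ × Term n → Set
Solves ρ x (k , T) = + suc k ℤ.* x ≡ ⟦ T ⟧t ρ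

-- At a point that is not far, (k + 1) x + t is some a with |a| ≤ (k + 1) D. Each of these 2 (k + 1)
-- D + 1 values proposes x = (a - t) / (k + 1); the index j encodes a as j - (k + 1) D.
near-candidates : ∀ {n} → ℕ → ℕ × Term n → List (ℕ × Term n)
near-candidates D (k , t) =
  List.map (λ j → k , con (+ j ℤ.- + (suc k ℕ.* D)) ⊕ ((ℤ.- + 1) ⊛ t)) (upTo (suc (suc k ℕ.* D ℕ.+ suc k ℕ.* D)))

-- Without bounds the truth value is periodic in the variable, and the residues below `period φ`
-- cover all cases; otherwise a solution can be moved near a bound.
candidates : ∀ {n} → QF (suc n) → List (ℕ × Term n)
candidates φ = List.map (λ j → 0 , con (+ j)) (upTo (period φ)) ++ concatMap (near-candidates (period φ)) (bounds φ)

private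
  near-index : ∀ a M → ∣ a ∣ ℕ.≤ M → Σ ℕ λ j → (j ℕ.< suc (M ℕ.+ M)) × (+ j ℤ.- + M ≡ a)
  near-index a M a≤M = ∣ a ℤ.+ + M ∣ , ℕ.s≤s (ℕₚ.≤-trans (ℤₚ.∣i+j∣≤∣i∣+∣j∣ a (+ M)) (ℕₚ.+-monoˡ-≤ M a≤M)) ,
    trans (cong (ℤ._- + M) (ℤₚ.0≤i⇒+∣i∣≡i nonneg)) (lem a (+ M))
    where
    lem : ∀ a m → a ℤ.+ m ℤ.- m ≡ a
    lem = solve-∀
    -a≤ : ∀ a → ℤ.- a ℤ.≤ + ∣ a ∣
    -a≤ (+ 0)     = ℤₚ.≤-refl
    -a≤ (+ suc n) = ℤ.-≤+
    -a≤ -[1+ n ]  = ℤₚ.≤-refl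
    nonneg : 0ℤ ℤ.≤ a ℤ.+ + M
    nonneg = subst (ℤ._≤ a ℤ.+ + M) (ℤₚ.+-inverseʳ a) (ℤₚ.+-monoʳ-≤ a (ℤₚ.≤-trans (-a≤ a) (ℤ.+≤+ a≤M)))

  near-solves : ∀ {n} (ρ : Env n) D x b → ¬ Far ρ D x b → Any (Solves ρ x) (near-candidates D b)
  near-solves ρ D x (k , t) ¬far =
    let j , j< , eq = near-index (+ suc k ℤ.* x ℤ.+ ⟦ t ⟧t ρ) (suc k ℕ.* D) (ℕₚ.≮⇒≥ ¬far)
    in Anyₚ.map⁺ (lose (∈-upTo⁺ j<) (trans (lem (+ suc k ℤ.* x) (⟦ t ⟧t ρ)) (cong (ℤ._+ (ℤ.- + 1) ℤ.* ⟦ t ⟧t ρ) (sym eq))))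
    where lem : ∀ a t → a ≡ a ℤ.+ t ℤ.+ (ℤ.- + 1) ℤ.* t
          lem = solve-∀

  -- Used with `b = suc k * D`, the change of a bound's value under a shift by one period: one of
  -- the two directions leads towards the bound.
  abs-decrease : ∀ a b → 0 ℕ.< b → b ℕ.< ∣ a ∣ →
    (∣ a ℤ.- + b ∣ ℕ.< ∣ a ∣) ⊎ (∣ a ℤ.+ + b ∣ ℕ.< ∣ a ∣)
  abs-decrease (+ m) (suc b) _ b<m = inj₁ lem
    where lem : ∣ m ℤ.⊖ suc b ∣ ℕ.< m
          lem rewrite ℤₚ.⊖-≥ (ℕₚ.<⇒≤ b<m) = ℕₚ.∸-monoʳ-< {m} {suc b} {0} (ℕ.s≤s ℕ.z≤n) (ℕₚ.<⇒≤ b<m)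
  abs-decrease -[1+ m ] (suc b) _ b<m = inj₂ lem
    where lem : ∣ suc b ℤ.⊖ suc m ∣ ℕ.< suc m
          lem rewrite ℤₚ.⊖-< b<m | ℤₚ.∣-i∣≡∣i∣ (+ (suc m ℕ.∸ suc b)) = ℕₚ.∸-monoʳ-< {suc m} {suc b} {0} (ℕ.s≤s ℕ.z≤n) (ℕₚ.<⇒≤ b<m)

-- While x is far from all bounds it can be moved by a period towards one of them without
-- changing the truth value, until it becomes a candidate.
module _ {n} (φ : QF (suc n)) (ρ : Env n) where
  private
    D = period φ
    instance D≢0 = period≢0 φ

  Candidate : Set
  Candidate = Σ ℤ λ x → Sat φ (extend x ρ) × Any (Solves ρ x) (candidates φ)

  private
    approach : ∀ fuel b → b ∈ bounds φ → ∀ x → ∣ Value ρ x b ∣ ℕ.≤ fuel → Sat φ (extend x ρ) → Candidate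
    approach fuel b b∈ x m s with All.all? (far? ρ D x) (bounds φ)
    ... | no ¬far = x , s , Anyₚ.++⁺ʳ (List.map (λ j → 0 , con (+ j)) (upTo D))
                             (Anyₚ.concatMap⁺ (near-candidates D) (Any.map (near-solves ρ D x _) (Allₚ.¬All⇒Any¬ (far? ρ D x) _ ¬far)))
    ... | yes far = go fuel m
      where
      k = proj₁ b
      farb = All.lookup far b∈
      lem : ∀ k x e t → k ℤ.* x ℤ.+ t ℤ.+ k ℤ.* e ≡ k ℤ.* (x ℤ.+ e) ℤ.+ t
      lem = solve-∀
      moved : ∀ e → ∣ e ∣ ≡ D → + D ∣ e → Sat φ (extend (x ℤ.+ e) ρ)
      moved e e≡ D∣e = proj₁ (shift-invariant φ ρ x e D∣e (subst (λ d → All (Far ρ d x) (bounds φ)) (sym e≡) far)) s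
      val : ∀ e → Value ρ (x ℤ.+ e) b ≡ Value ρ x b ℤ.+ + suc k ℤ.* e
      val e = sym (lem (+ suc k) x e _)
      pos : 0 ℕ.< suc k ℕ.* D
      pos = ℕ.>-nonZero⁻¹ _ {{ℕₚ.m*n≢0 (suc k) D}}
      go : ∀ fuel → ∣ Value ρ x b ∣ ℕ.≤ fuel → Candidate
      go zero m = ⊥-elim (ℕₚ.<⇒≱ farb (ℕₚ.≤-trans m ℕ.z≤n))
      go (suc fuel) m with abs-decrease (Value ρ x b) (suc k ℕ.* D) pos farb
      ... | inj₁ dec = approach fuel b b∈ (x ℤ.+ ℤ.- + D) (ℕₚ.≤-pred (ℕₚ.≤-trans (subst (ℕ._< _) (cong ∣_∣ eq) dec) m))
                        (moved (ℤ.- + D) (ℤₚ.∣-i∣≡∣i∣ (+ D)) (∣m⇒∣-m ∣-refl))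
        where eq : Value ρ x b ℤ.- + (suc k ℕ.* D) ≡ Value ρ (x ℤ.+ ℤ.- + D) b
              eq = trans (cong (λ z → Value ρ x b ℤ.- z) (ℤₚ.pos-* (suc k) D))
                     (trans (cong (λ z → Value ρ x b ℤ.+ z) (ℤₚ.neg-distribʳ-* (+ suc k) (+ D))) (sym (val (ℤ.- + D))))
      ... | inj₂ dec = approach fuel b b∈ (x ℤ.+ + D) (ℕₚ.≤-pred (ℕₚ.≤-trans (subst (ℕ._< _) (cong ∣_∣ eq) dec) m))
                        (moved (+ D) refl ∣-refl)
        where eq : Value ρ x b ℤ.+ + (suc k ℕ.* D) ≡ Value ρ (x ℤ.+ + D) b
              eq = trans (cong (λ z → Value ρ x b ℤ.+ z) (ℤₚ.pos-* (suc k) D)) (sym (val (+ D)))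

  candidate : ∀ x → Sat φ (extend x ρ) → Candidate
  candidate x s = go (bounds φ) refl
    where
    r = x %ℕ D
    go : ∀ bs → bs ≡ bounds φ → Candidate
    go (b ∷ bs) eq = approach _ b (subst (b ∈_) eq (here refl)) x ℕₚ.≤-refl s
    go [] eq = + r , subst (λ z → Sat φ (extend z ρ)) x+e≡r
                       (proj₁ (shift-invariant φ ρ x e (divides (ℤ.- (x /ℕ D)) refl) (subst (All _) eq [])) s) ,
               Anyₚ.++⁺ˡ (Anyₚ.map⁺ (lose (∈-upTo⁺ (n%ℕd<d x D)) (ℤₚ.*-identityˡ (+ r))))
      where
      e = ℤ.- (x /ℕ D) ℤ.* + D
      lem : ∀ r q d → r ℤ.+ q ℤ.* d ℤ.+ ℤ.- q ℤ.* d ≡ r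
      lem = solve-∀
      x+e≡r : x ℤ.+ e ≡ + r
      x+e≡r = trans (cong (ℤ._+ e) (a≡a%ℕn+[a/ℕn]*n x D)) (lem (+ r) (x /ℕ D) (+ D))

-- Substitution of T / (k + 1) for the variable, with denominators cleared.
sub : ∀ {n} → ℕ → Term n → QF (suc n) → QF n
sub k T (le t)   = le ((coef t ⊛ T) ⊕ ((+ suc k) ⊛ rest t))
-- `dv` stores its modulus minus one; the new modulus is (k + 1)(d + 1).
sub k T (dv d t) = dv (d ℕ.+ k ℕ.* suc d) ((coef t ⊛ T) ⊕ ((+ suc k) ⊛ rest t))
sub k T (no′ φ)  = no′ (sub k T φ)
sub k T (an φ ψ) = an (sub k T φ) (sub k T ψ)
sub k T (or φ ψ) = or (sub k T φ) (sub k T ψ)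

private
  sub-term : ∀ {n} k (T : Term n) t ρ x → Solves ρ x (k , T) →
    coef t ℤ.* ⟦ T ⟧t ρ ℤ.+ + suc k ℤ.* ⟦ rest t ⟧t ρ ≡ + suc k ℤ.* ⟦ t ⟧t (extend x ρ)
  sub-term k T t ρ x eq = trans (cong (λ z → coef t ℤ.* z ℤ.+ _) (sym eq))
    (trans (lem (coef t) (+ suc k) x _) (cong (+ suc k ℤ.*_) (sym (term-split t (extend x ρ)))))
    where lem : ∀ c k x r → c ℤ.* (k ℤ.* x) ℤ.+ k ℤ.* r ≡ k ℤ.* (c ℤ.* x ℤ.+ r)
          lem = solve-∀

  scale-≤0 : ∀ k a → (+ suc k ℤ.* a ℤ.≤ 0ℤ) ⟺ (a ℤ.≤ 0ℤ)
  scale-≤0 k a =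
    (λ p → ℤₚ.*-cancelˡ-≤-pos a 0ℤ (+ suc k) (subst (+ suc k ℤ.* a ℤ.≤_) (sym (ℤₚ.*-zeroʳ (+ suc k))) p)) ,
    (λ p → subst (+ suc k ℤ.* a ℤ.≤_) (ℤₚ.*-zeroʳ (+ suc k)) (ℤₚ.*-monoˡ-≤-nonNeg (+ suc k) p))

Sat-sub : ∀ {n} k (T : Term n) (φ : QF (suc n)) ρ x → Solves ρ x (k , T) → Sat (sub k T φ) ρ ⟺ Sat φ (extend x ρ)
Sat-sub k T (le t) ρ x eq = ⟺-trans (≤0-resp (sub-term k T t ρ x eq)) (scale-≤0 k _)
Sat-sub k T (dv d t) ρ x eq =
  (λ p → *-cancelˡ-∣ (+ suc k) (subst₂ _∣_ (ℤₚ.pos-* (suc k) (suc d)) (sub-term k T t ρ x eq) p)) ,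
  (λ p → subst₂ _∣_ (sym (ℤₚ.pos-* (suc k) (suc d))) (sym (sub-term k T t ρ x eq)) (*-monoʳ-∣ (+ suc k) p))
Sat-sub k T (no′ φ) ρ x eq = ¬-cong (Sat-sub k T φ ρ x eq)
Sat-sub k T (an φ ψ) ρ x eq = ×-cong (Sat-sub k T φ ρ x eq) (Sat-sub k T ψ ρ x eq)
Sat-sub k T (or φ ψ) ρ x eq = ⊎-cong (Sat-sub k T φ ρ x eq) (Sat-sub k T ψ ρ x eq)

-- The conjunct `dv k T` makes T / (k + 1) an integer; `sub` alone would accept fractions.
at : ∀ {n} → QF (suc n) → ℕ × Term n → QF n
at φ (k , T) = an (dv k T) (sub k T φ)

Sat-at⁺ : ∀ {n} (φ : QF (suc n)) ρ {x c} → Solves ρ x c → Sat φ (extend x ρ) → Sat (at φ c) ρ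
Sat-at⁺ φ ρ {x} {k , T} eq s = divides x (trans (sym eq) (ℤₚ.*-comm (+ suc k) x)) , proj₂ (Sat-sub k T φ ρ x eq) s

Sat-at⁻ : ∀ {n} (φ : QF (suc n)) ρ c → Sat (at φ c) ρ → Σ ℤ λ x → Solves ρ x c × Sat φ (extend x ρ)
Sat-at⁻ φ ρ (k , T) (divides x eq , s) = x , e , proj₁ (Sat-sub k T φ ρ x e) s
  where e = trans (ℤₚ.*-comm (+ suc k) x) (sym eq)

anyOf : ∀ {n} → List (QF n) → QF n
anyOf []       = le (con (+ 1))
anyOf (φ ∷ φs) = or φ (anyOf φs)

Sat-anyOf : ∀ {n} (φs : List (QF n)) ρ → Sat (anyOf φs) ρ ⟺ Any (λ φ → Sat φ ρ) φs
Sat-anyOf [] ρ = (λ { (ℤ.+≤+ ()) }) , λ ()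
Sat-anyOf (φ ∷ φs) ρ =
  [ here , there ∘ proj₁ (Sat-anyOf φs ρ) ]′ ,
  λ { (here p) → inj₁ p ; (there p) → inj₂ (proj₂ (Sat-anyOf φs ρ) p) }

elim : ∀ {n} → QF (suc n) → QF n
elim φ = anyOf (List.map (at φ) (candidates φ))

Sat-elim : ∀ {n} (φ : QF (suc n)) ρ → Sat (elim φ) ρ ⟺ Σ ℤ λ x → Sat φ (extend x ρ)
Sat-elim φ ρ =
  (λ p → let c , s = Any.satisfied (Anyₚ.map⁻ (proj₁ (Sat-anyOf _ ρ) p)) ; x , _ , sx = Sat-at⁻ φ ρ c s in x , sx) ,
  (λ (x , s) → let x′ , s′ , c = candidate φ ρ x s
               in proj₂ (Sat-anyOf (List.map (at φ) (candidates φ)) ρ) (Anyₚ.map⁺ (Any.map (λ e → Sat-at⁺ φ ρ e s′) c)))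

-- Canonical representatives and definable predicates

ι : ∀ k → ℤ → Zk k
ι zero    s = s
ι (suc k) s = fromℕ< (n%ℕd<d s (suc k))

private
  diff-cancel : ∀ a b c d x → (a ℤ.+ c ℤ.* x) ℤ.- (b ℤ.+ d ℤ.* x) ℤ.+ (d ℤ.- c) ℤ.* x ≡ a ℤ.- b
  diff-cancel = solve-∀

  remainders-agree : ∀ {d r s} → r ℕ.< d → s ℕ.< d → + d ∣ + r ℤ.- + s → r ≡ s
  remainders-agree {d} {r} {s} r<d s<d p = ℤₚ.+-injective (ℤₚ.i-j≡0⇒i≡j (+ r) (+ s) (ℤₚ.∣i∣≡0⇒i≡0 abs≡0))
    where
    abs<d : ∣ + r ℤ.- + s ∣ ℕ.< d
    abs<d = ℕₚ.≤-<-trans (subst (λ z → ∣ z ∣ ℕ.≤ r ℕ.⊔ s) (sym (ℤₚ.[+m]-[+n]≡m⊖n r s)) (ℤₚ.∣m⊝n∣≤m⊔n r s))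
                         (ℕₚ.⊔-lub r<d s<d)
    abs≡0 : ∣ + r ℤ.- + s ∣ ≡ 0
    abs≡0 with ∣ + r ℤ.- + s ∣ | abs<d | ∣⇒∣ᵤ p
    ... | zero  | _  | _ = refl
    ... | suc m | lt | q = contradiction (ℕᵈ.∣⇒≤ q) (ℕₚ.<⇒≱ lt)

%ℕ-cong : ∀ d .{{_ : ℕ.NonZero d}} a b → (a %ℕ d ≡ b %ℕ d) ⟺ (+ d ∣ a ℤ.- b)
%ℕ-cong d a b =
  (λ eq → divides (a /ℕ d ℤ.- b /ℕ d) (trans (cong₂ ℤ._-_ (a≡a%ℕn+[a/ℕn]*n a d) (a≡a%ℕn+[a/ℕn]*n b d))
      (trans (cong (λ r → (+ r ℤ.+ (a /ℕ d) ℤ.* + d) ℤ.- (+ (b %ℕ d) ℤ.+ (b /ℕ d) ℤ.* + d)) eq) (lem (+ (b %ℕ d)) (a /ℕ d) (b /ℕ d) (+ d))))) ,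
  (λ p → remainders-agree (n%ℕd<d a d) (n%ℕd<d b d)
      (subst (+ d ∣_) (diff-cancel (+ (a %ℕ d)) (+ (b %ℕ d)) (a /ℕ d) (b /ℕ d) (+ d))
        (∣m∣n⇒∣m+n (subst (+ d ∣_) (cong₂ ℤ._-_ (a≡a%ℕn+[a/ℕn]*n a d) (a≡a%ℕn+[a/ℕn]*n b d)) p)
                   (∣n⇒∣m*n (b /ℕ d ℤ.- a /ℕ d) ∣-refl))))
  where
  lem : ∀ r x y d → (r ℤ.+ x ℤ.* d) ℤ.- (r ℤ.+ y ℤ.* d) ≡ (x ℤ.- y) ℤ.* d
  lem = solve-∀

ι-≡ : ∀ k s s′ → (ι k s ≡ ι k s′) ⟺ (+ k ∣ s ℤ.- s′)
ι-≡ zero s s′ = (λ { refl → divides 0ℤ (ℤₚ.+-inverseʳ s) }) , λ p → ℤₚ.i-j≡0⇒i≡j s s′ (0∣⇒≡0 p)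
ι-≡ (suc k) s s′ =
  (λ eq → proj₁ (%ℕ-cong (suc k) s s′) (Finₚ.fromℕ<-injective (s %ℕ suc k) (s′ %ℕ suc k) (n%ℕd<d s (suc k)) (n%ℕd<d s′ (suc k)) eq)) ,
  (λ p → Finₚ.fromℕ<-cong (s %ℕ suc k) (s′ %ℕ suc k) (proj₂ (%ℕ-cong (suc k) s s′) p) (n%ℕd<d s (suc k)) (n%ℕd<d s′ (suc k)))

rep-ι : ∀ k s → + k ∣ s ℤ.- rep k (ι k s)
rep-ι zero s = divides 0ℤ (ℤₚ.+-inverseʳ s)
rep-ι (suc k) s rewrite Finₚ.toℕ-fromℕ< (n%ℕd<d s (suc k)) =
  divides (s /ℕ suc k) (trans (cong (ℤ._- + (s %ℕ suc k)) (a≡a%ℕn+[a/ℕn]*n s (suc k))) (lem (+ (s %ℕ suc k)) _))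
  where lem : ∀ r q → r ℤ.+ q ℤ.- r ≡ q
        lem = solve-∀

∣-flip : ∀ {k} a b → k ∣ a ℤ.- b → k ∣ b ℤ.- a
∣-flip {k} a b p = subst (k ∣_) (lem a b) (∣m⇒∣-m p)
  where lem : ∀ a b → ℤ.- (a ℤ.- b) ≡ b ℤ.- a
        lem = solve-∀

ι-rep : ∀ k x → ι k (rep k x) ≡ x
ι-rep zero x = refl
ι-rep (suc k) x = Finₚ.toℕ-injective (trans (Finₚ.toℕ-fromℕ< _)
  (remainders-agree (n%ℕd<d (+ toℕ x) (suc k)) (Finₚ.toℕ<n x)
    (∣-flip (+ toℕ x) (+ ((+ toℕ x) %ℕ suc k)) (subst (λ r → + suc k ∣ + toℕ x ℤ.- + r) (Finₚ.toℕ-fromℕ< (n%ℕd<d (+ toℕ x) (suc k))) (rep-ι (suc k) (+ toℕ x))))))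

act-rep : ∀ k z x → act k z x ≡ ι k (rep k x ℤ.+ z)
act-rep zero    z x = refl
act-rep (suc k) z x = refl

Canonical : ℕ → ℤ → Set
Canonical zero    x = ⊤
Canonical (suc k) x = (0ℤ ℤ.≤ x) × (x ℤ.≤ + k)

canonical-rep : ∀ k x → Canonical k (rep k x)
canonical-rep zero    x = tt
canonical-rep (suc k) x = ℤ.+≤+ ℕ.z≤n , ℤ.+≤+ (ℕₚ.≤-pred (Finₚ.toℕ<n x))

canonical-unique : ∀ k s x → Canonical k x → + k ∣ s ℤ.- x → x ≡ rep k (ι k s)
canonical-unique zero s x _ p = sym (ℤₚ.i-j≡0⇒i≡j s x (0∣⇒≡0 p))
canonical-unique (suc k) s (+ n) (_ , ℤ.+≤+ n≤k) p = cong +_ (trans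
  (remainders-agree (ℕ.s≤s n≤k) (n%ℕd<d s (suc k))
    (subst (+ suc k ∣_) (lem (+ n) s (+ (s %ℕ suc k)))
      (∣m∣n⇒∣m-n (subst (λ r → + suc k ∣ s ℤ.- + r) (Finₚ.toℕ-fromℕ< (n%ℕd<d s (suc k))) (rep-ι (suc k) s)) p)))
  (sym (Finₚ.toℕ-fromℕ< (n%ℕd<d s (suc k)))))
  where lem : ∀ n s r → (s ℤ.- r) ℤ.- (s ℤ.- n) ≡ n ℤ.- r
        lem = solve-∀

module Points (ks : List ℕ) where
  Orb = Fin (length ks)

  pt : Orb → ℤ → Elt ks
  pt i s = i , ι (lookup ks i) s

  pt-rep : ∀ q → pt (orbit ks q) (repE ks q) ≡ q
  pt-rep (i , x) = cong (i ,_) (ι-rep (lookup ks i) x)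

  pt-cong : ∀ i s s′ → + lookup ks i ∣ s ℤ.- s′ → pt i s ≡ pt i s′
  pt-cong i s s′ p = cong (i ,_) (proj₂ (ι-≡ _ s s′) p)

  pt-injective : ∀ {i j s s′} → pt i s ≡ pt j s′ → Σ (i ≡ j) λ _ → + lookup ks i ∣ s ℤ.- s′
  pt-injective {i} {j} {s} {s′} eq = go (cong proj₁ eq) eq
    where
    go : i ≡ j → pt i s ≡ pt j s′ → Σ (i ≡ j) λ _ → + lookup ks i ∣ s ℤ.- s′
    go refl eq = refl , proj₁ (ι-≡ _ s s′) (trans (sym (ι-rep _ _)) (trans (cong (ι _) (rep≡ eq)) (ι-rep _ _)))
      where rep≡ : ∀ {x y : Zk (lookup ks i)} → _≡_ {A = Elt ks} (i , x) (i , y) → rep _ x ≡ rep _ y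
            rep≡ eq = cong (repE ks) eq

  actE-pt : ∀ z i s → actE ks z (pt i s) ≡ pt i (s ℤ.+ z)
  actE-pt z i s = cong (i ,_) (trans (act-rep (lookup ks i) z _) (proj₂ (ι-≡ _ _ _)
    (subst (_ ∣_) (lem (rep k (ι k s)) z s) (∣-flip s (rep k (ι k s)) (rep-ι k s)))))
    where k = lookup ks i
          lem : ∀ r z s → r ℤ.- s ≡ r ℤ.+ z ℤ.- (s ℤ.+ z)
          lem = solve-∀

  actE-rep : ∀ z q → actE ks z q ≡ pt (orbit ks q) (repE ks q ℤ.+ z)
  actE-rep z (i , x) = cong (i ,_) (act-rep (lookup ks i) z x)

  actE-0 : ∀ q → actE ks 0ℤ q ≡ q
  actE-0 q = trans (actE-rep 0ℤ q) (trans (cong (pt _) (ℤₚ.+-identityʳ _)) (pt-rep q))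

  actE-+ : ∀ y z q → actE ks z (actE ks y q) ≡ actE ks (y ℤ.+ z) q
  actE-+ y z q = trans (cong (actE ks z) (actE-rep y q)) (trans (actE-pt z _ _)
    (trans (cong (pt _) (ℤₚ.+-assoc (repE ks q) y z)) (sym (actE-rep (y ℤ.+ z) q))))

record TDfn (n : ℕ) (f : Env n → ℤ) : Set where
  constructor tdfn
  field
    term    : Term n
    correct : ∀ ρ → ⟦ term ⟧t ρ ≡ f ρ

-- Bundling a predicate with a quantifier-free equivalent lets a first-order statement be built once
-- with the combinators below; its decision procedure and its formula both come from that one
-- construction.
record Dfn (n : ℕ) (P : Env n → Set) : Set where
  constructor dfn
  field
    formula : QF n
    correct : ∀ ρ → Sat formula ρ ⟺ P ρ

infixl 6 _+T_ _-T_
infixr 2 _×D_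
infixr 1 _→D_

varT : ∀ {n} i → TDfn n (λ ρ → ρ i)
varT i = tdfn (var i) (λ ρ → refl)

conT : ∀ {n} c → TDfn n (λ _ → c)
conT c = tdfn (con c) (λ ρ → refl)

_+T_ : ∀ {n f g} → TDfn n f → TDfn n g → TDfn n (λ ρ → f ρ ℤ.+ g ρ)
tdfn s p +T tdfn t q = tdfn (s ⊕ t) (λ ρ → cong₂ ℤ._+_ (p ρ) (q ρ))

_-T_ : ∀ {n f g} → TDfn n f → TDfn n g → TDfn n (λ ρ → f ρ ℤ.- g ρ)
tdfn s p -T tdfn t q = tdfn (s ⊕ ((ℤ.- + 1) ⊛ t)) (λ ρ → cong₂ ℤ._+_ (p ρ) (trans (ℤₚ.-1*i≡-i _) (cong ℤ.-_ (q ρ))))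

substTerm : ∀ {m n} → (Fin n → Term m) → Term n → Term m
substTerm ts (var i) = ts i
substTerm ts (con c) = con c
substTerm ts (s ⊕ t) = substTerm ts s ⊕ substTerm ts t
substTerm ts (c ⊛ t) = c ⊛ substTerm ts t

substTerm-correct : ∀ {m n} (ts : Fin n → Term m) t {ρ ρ′} → (∀ i → ⟦ ts i ⟧t ρ ≡ ρ′ i) → ⟦ substTerm ts t ⟧t ρ ≡ ⟦ t ⟧t ρ′
substTerm-correct ts (var i) eq = eq i
substTerm-correct ts (con c) eq = refl
substTerm-correct ts (s ⊕ t) eq = cong₂ ℤ._+_ (substTerm-correct ts s eq) (substTerm-correct ts t eq)
substTerm-correct ts (c ⊛ t) eq = cong (c ℤ.*_) (substTerm-correct ts t eq)

wkT : ∀ {n f} → TDfn n f → TDfn (suc n) (λ ρ → f (ρ ∘ Fin.suc))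
wkT (tdfn t p) = tdfn (substTerm (var ∘ Fin.suc) t) (λ ρ → trans (substTerm-correct (var ∘ Fin.suc) t (λ i → refl)) (p (ρ ∘ Fin.suc)))

substQF : ∀ {m n} → (Fin n → Term m) → QF n → QF m
substQF ts (le t)   = le (substTerm ts t)
substQF ts (dv d t) = dv d (substTerm ts t)
substQF ts (no′ φ)  = no′ (substQF ts φ)
substQF ts (an φ ψ) = an (substQF ts φ) (substQF ts ψ)
substQF ts (or φ ψ) = or (substQF ts φ) (substQF ts ψ)

≡⇒⟺ : ∀ {A B : Set} → A ≡ B → A ⟺ B
≡⇒⟺ refl = ⟺-refl

substQF-correct : ∀ {m n} (ts : Fin n → Term m) φ {ρ ρ′} → (∀ i → ⟦ ts i ⟧t ρ ≡ ρ′ i) → Sat (substQF ts φ) ρ ⟺ Sat φ ρ′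
substQF-correct ts (le t)   eq = ≡⇒⟺ (cong (ℤ._≤ 0ℤ) (substTerm-correct ts t eq))
substQF-correct ts (dv d t) eq = ≡⇒⟺ (cong (+ suc d ∣_) (substTerm-correct ts t eq))
substQF-correct ts (no′ φ)  eq = ¬-cong (substQF-correct ts φ eq)
substQF-correct ts (an φ ψ) eq = ×-cong (substQF-correct ts φ eq) (substQF-correct ts ψ eq)
substQF-correct ts (or φ ψ) eq = ⊎-cong (substQF-correct ts φ eq) (substQF-correct ts ψ eq)

substD : ∀ {m n P} → Dfn n P → {e : Env m → Env n} → (∀ i → TDfn m (λ ρ → e ρ i)) → Dfn m (λ ρ → P (e ρ))
substD (dfn φ p) ts = dfn (substQF (TDfn.term ∘ ts) φ)
  (λ ρ → ⟺-trans (substQF-correct (TDfn.term ∘ ts) φ (λ i → TDfn.correct (ts i) ρ)) (p _))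

mapD : ∀ {n P Q} → (∀ ρ → P ρ ⟺ Q ρ) → Dfn n P → Dfn n Q
mapD eq (dfn φ p) = dfn φ (λ ρ → ⟺-trans (p ρ) (eq ρ))

decD : ∀ {n P} → Dfn n P → ∀ ρ → Dec (P ρ)
decD (dfn φ p) ρ = map′ (proj₁ (p ρ)) (proj₂ (p ρ)) (sat? φ ρ)

-- Environments are functions, and pointwise equal ones are not identified. A definable predicate
-- cannot tell them apart because a formula only looks up values.
respects : ∀ {n P} → Dfn n P → ∀ {ρ ρ′} → (∀ i → ρ i ≡ ρ′ i) → P ρ → P ρ′
respects (dfn φ p) {ρ} {ρ′} eq = proj₁ (p ρ′) ∘ proj₁ (substQF-correct var φ eq) ∘ proj₂ (substQF-correct var φ (λ _ → refl)) ∘ proj₂ (p ρ)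

_≤D_ : ∀ {n f g} → TDfn n f → TDfn n g → Dfn n (λ ρ → f ρ ℤ.≤ g ρ)
s ≤D t = dfn (le (TDfn.term (s -T t))) (λ ρ → ⟺-trans (≡⇒⟺ (cong (ℤ._≤ 0ℤ) (TDfn.correct (s -T t) ρ))) (ℤₚ.i-j≤0⇒i≤j , ℤₚ.i≤j⇒i-j≤0))

_×D_ : ∀ {n P Q} → Dfn n P → Dfn n Q → Dfn n (λ ρ → P ρ × Q ρ)
dfn φ p ×D dfn ψ q = dfn (an φ ψ) (λ ρ → ×-cong (p ρ) (q ρ))

_⊎D_ : ∀ {n P Q} → Dfn n P → Dfn n Q → Dfn n (λ ρ → P ρ ⊎ Q ρ)
dfn φ p ⊎D dfn ψ q = dfn (or φ ψ) (λ ρ → ⊎-cong (p ρ) (q ρ))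

¬D_ : ∀ {n P} → Dfn n P → Dfn n (λ ρ → ¬ P ρ)
¬D dfn φ p = dfn (no′ φ) (λ ρ → ¬-cong (p ρ))

-- Encoded as ¬ (P ∧ ¬ Q), which gives back the implication because a definable `Q` is decidable,
-- hence stable. `∀E` rests on the same fact.
_→D_ : ∀ {n P Q} → Dfn n P → Dfn n Q → Dfn n (λ ρ → P ρ → Q ρ)
P →D Q = mapD (λ ρ → (λ h p → decidable-stable (decD Q ρ) (λ ¬q → h (p , ¬q))) , (λ f (p , ¬q) → ¬q (f p))) (¬D (P ×D (¬D Q)))

constD : ∀ {n} {A : Set} → Dec A → Dfn n (λ _ → A)
constD (yes a) = dfn (le (con (+ 0))) (λ ρ → (λ _ → a) , λ _ → ℤₚ.≤-refl)
constD (no ¬a) = dfn (le (con (+ 1))) (λ ρ → (λ { (ℤ.+≤+ ()) }) , λ a → contradiction a ¬a)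

_≡D_ : ∀ {n f g} → TDfn n f → TDfn n g → Dfn n (λ ρ → f ρ ≡ g ρ)
s ≡D t = mapD (λ ρ → (λ (p , q) → ℤₚ.≤-antisym p q) , λ eq → ℤₚ.≤-reflexive eq , ℤₚ.≤-reflexive (sym eq)) ((s ≤D t) ×D (t ≤D s))

divD : ∀ {n f} d → TDfn n f → Dfn n (λ ρ → + d ∣ f ρ)
divD zero    t = mapD (λ ρ → (λ eq → divides 0ℤ eq) , 0∣⇒≡0) (t ≡D conT 0ℤ)
divD (suc d) t = dfn (dv d (TDfn.term t)) (λ ρ → ≡⇒⟺ (cong (+ suc d ∣_) (TDfn.correct t ρ)))

∃E : ∀ {n Q} → Dfn (suc n) Q → Dfn n (λ ρ → Σ ℤ λ x → Q (extend x ρ))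
∃E (dfn φ p) = dfn (elim φ) (λ ρ → ⟺-trans (Sat-elim φ ρ)
  ((λ (x , s) → x , proj₁ (p _) s) , (λ (x , s) → x , proj₂ (p _) s)))

-- Separates the bound variable from the environment in `P`; this agrees with `∃E` because
-- `extend x ρ ∘ Fin.suc` is `ρ` by eta.
∃D : ∀ {n} {P : ℤ → Env n → Set} → Dfn (suc n) (λ ρ → P (ρ Fin.zero) (ρ ∘ Fin.suc)) → Dfn n (λ ρ → Σ ℤ λ x → P x ρ)
∃D = ∃E

∀E : ∀ {n Q} → Dfn (suc n) Q → Dfn n (λ ρ → ∀ x → Q (extend x ρ))
∀E Q = mapD (λ ρ → (λ h x → decidable-stable (decD Q _) (λ ¬q → h (x , ¬q))) , (λ f (x , ¬q) → ¬q (f x))) (¬D ∃E (¬D Q))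

∀D : ∀ {n} {P : ℤ → Env n → Set} → Dfn (suc n) (λ ρ → P (ρ Fin.zero) (ρ ∘ Fin.suc)) → Dfn n (λ ρ → ∀ x → P x ρ)
∀D = ∀E

∃FinD : ∀ {n m} {P : Fin m → Env n → Set} → (∀ i → Dfn n (P i)) → Dfn n (λ ρ → Σ (Fin m) λ i → P i ρ)
∃FinD {m = zero}  Ps = mapD (λ ρ → (λ ()) , λ ()) (constD {A = ⊥} (no id))
∃FinD {m = suc m} Ps = mapD (λ ρ → [ (λ p → Fin.zero , p) , (λ (i , p) → Fin.suc i , p) ]′ ,
                                   λ { (Fin.zero , p) → inj₁ p ; (Fin.suc i , p) → inj₂ (i , p) })
                            (Ps Fin.zero ⊎D ∃FinD (Ps ∘ Fin.suc))

∀FinD : ∀ {n m} {P : Fin m → Env n → Set} → (∀ i → Dfn n (P i)) → Dfn n (λ ρ → ∀ i → P i ρ)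
∀FinD {m = zero}  Ps = mapD (λ ρ → (λ _ ()) , λ _ → tt) (constD {A = ⊤} (yes tt))
∀FinD {m = suc m} Ps = mapD (λ ρ → (λ { (p , f) Fin.zero → p ; (p , f) (Fin.suc i) → f i }) , λ f → f Fin.zero , f ∘ Fin.suc)
                            (Ps Fin.zero ×D ∀FinD (Ps ∘ Fin.suc))

formulaD : ∀ {n} (φ : Formula n) → Dfn n ⟦ φ ⟧
formulaD tt       = constD (yes tt)
formulaD ff       = constD (no id)
formulaD (s ≤′ t) = tdfn s (λ _ → refl) ≤D tdfn t (λ _ → refl)
formulaD (s ≐′ t) = tdfn s (λ _ → refl) ≡D tdfn t (λ _ → refl)
formulaD (d ∣′ t) = mapD (λ ρ → (λ (divides q eq) → q , eq) , λ (q , eq) → divides q eq) (divD d (tdfn t (λ _ → refl)))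
formulaD (¬′ φ)   = ¬D formulaD φ
formulaD (φ ∧′ ψ) = formulaD φ ×D formulaD ψ
formulaD (φ ∨′ ψ) = formulaD φ ⊎D formulaD ψ
formulaD (∃′ φ)   = ∃E (formulaD φ)
formulaD (∀′ φ)   = ∀E (formulaD φ)

toFormula : ∀ {n} → QF n → Formula n
toFormula (le t)   = t ≤′ con 0ℤ
toFormula (dv d t) = suc d ∣′ t
toFormula (no′ φ)  = ¬′ toFormula φ
toFormula (an φ ψ) = toFormula φ ∧′ toFormula ψ
toFormula (or φ ψ) = toFormula φ ∨′ toFormula ψ

toFormula-correct : ∀ {n} (φ : QF n) ρ → ⟦ toFormula φ ⟧ ρ ⟺ Sat φ ρ
toFormula-correct (le t)   ρ = ⟺-refl
toFormula-correct (dv d t) ρ = (λ (q , eq) → divides q eq) , λ (divides q eq) → q , eq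
toFormula-correct (no′ φ)  ρ = ¬-cong (toFormula-correct φ ρ)
toFormula-correct (an φ ψ) ρ = ×-cong (toFormula-correct φ ρ) (toFormula-correct ψ ρ)
toFormula-correct (or φ ψ) ρ = ⊎-cong (toFormula-correct φ ρ) (toFormula-correct ψ ρ)

formulaOf : ∀ {n P} → Dfn n P → Formula n
formulaOf (dfn φ _) = toFormula φ

formulaOf-correct : ∀ {n P} (d : Dfn n P) ρ → ⟦ formulaOf d ⟧ ρ ⟺ P ρ
formulaOf-correct (dfn φ p) ρ = ⟺-trans (toFormula-correct φ ρ) (p ρ)

canonicalD : ∀ {n f} k → TDfn n f → Dfn n (λ ρ → Canonical k (f ρ))
canonicalD zero    t = constD (yes tt)
canonicalD (suc k) t = (conT 0ℤ ≤D t) ×D (t ≤D conT (+ k))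

-- The remainder modulo `k` is not a term, so the representative is bound by a quantifier and pinned
-- down as the only canonical integer congruent to `f ρ`.
repD : ∀ {n f} k → TDfn n f → {R : ℤ → Env n → Set} → Dfn (suc n) (λ ρ → R (ρ Fin.zero) (ρ ∘ Fin.suc)) →
  Dfn n (λ ρ → R (rep k (ι k (f ρ))) ρ)
repD {f = f} k t {R} r = mapD
  (λ ρ → (λ (x , c , d , p) → subst (λ x → R x ρ) (canonical-unique k (f ρ) x c d) p) ,
         (λ p → _ , canonical-rep k (ι k (f ρ)) , rep-ι k (f ρ) , p))
  (∃D {P = λ x ρ → Canonical k x × (+ k ∣ f ρ ℤ.- x) × R x ρ} (canonicalD k (varT Fin.zero) ×D divD k (wkT t -T varT Fin.zero) ×D r))

module _ (ks : List ℕ) where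
  open Points ks

  ∀EltD : ∀ {n} {P : Elt ks → Env n → Set} → (∀ i → Dfn (suc n) (λ ρ → P (pt i (ρ Fin.zero)) (ρ ∘ Fin.suc))) →
    Dfn n (λ ρ → ∀ q → P q ρ)
  ∀EltD {P = P} d = mapD (λ ρ → (λ h q → subst (λ q → P q ρ) (pt-rep q) (h (orbit ks q) (repE ks q))) , λ h i x → h (pt i x)) (∀FinD (λ i → ∀D {P = λ x → P (pt i x)} (d i)))

  ∃EltD : ∀ {n} {P : Elt ks → Env n → Set} → (∀ i → Dfn (suc n) (λ ρ → P (pt i (ρ Fin.zero)) (ρ ∘ Fin.suc))) →
    Dfn n (λ ρ → Σ (Elt ks) λ q → P q ρ)
  ∃EltD {P = P} d = mapD (λ ρ → (λ (i , x , p) → pt i x , p) , λ (q , p) → _ , _ , subst (λ q → P q ρ) (sym (pt-rep q)) p)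
    (∃FinD (λ i → ∃D {P = λ x → P (pt i x)} (d i)))

  pt-≡D : ∀ {n f g} i j → TDfn n f → TDfn n g → Dfn n (λ ρ → pt i (f ρ) ≡ pt j (g ρ))
  pt-≡D i j s t with i Finₚ.≟ j
  ... | yes refl = mapD (λ ρ → pt-cong i _ _ , proj₂ ∘ pt-injective) (divD (lookup ks i) (s -T t))
  ... | no i≢j   = mapD (λ ρ → ⊥-elim , i≢j ∘ proj₁ ∘ pt-injective) (constD (no id))

-- The bound on periods

Bézout : ℤ → ℕ → Set
Bézout a m = Σ ℤ λ g → (g ∣ a) × (g ∣ + m) × Σ ℤ λ x → Σ ℤ λ y → g ≡ x ℤ.* a ℤ.+ y ℤ.* + m

bézout : ∀ m a → Bézout a m
bézout = <-rec (λ m → ∀ a → Bézout a m) descend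
  where
  lem : ∀ x y r q m → x ℤ.* m ℤ.+ y ℤ.* r ≡ y ℤ.* (r ℤ.+ q ℤ.* m) ℤ.+ (x ℤ.- y ℤ.* q) ℤ.* m
  lem = solve-∀
  lem₀ : ∀ a → a ≡ + 1 ℤ.* a ℤ.+ 0ℤ ℤ.* 0ℤ
  lem₀ = solve-∀
  descend : ∀ m → (∀ {k} → k ℕ.< m → ∀ a → Bézout a k) → ∀ a → Bézout a m
  descend zero rec a = a , ∣-refl , divides 0ℤ refl , + 1 , 0ℤ , lem₀ a
  descend m@(suc _) rec a with rec (n%ℕd<d a m) (+ m)
  ... | g , g∣m , g∣r , x , y , eq =
    g , subst (g ∣_) (sym a≡) (∣m∣n⇒∣m+n g∣r (∣n⇒∣m*n (a /ℕ m) g∣m)) , g∣m , y , x ℤ.- y ℤ.* (a /ℕ m) ,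
    trans eq (trans (lem x y (+ (a %ℕ m)) (a /ℕ m) (+ m)) (cong (λ z → y ℤ.* z ℤ.+ (x ℤ.- y ℤ.* (a /ℕ m)) ℤ.* + m) (sym a≡)))
    where a≡ = a≡a%ℕn+[a/ℕn]*n a m

-- With g = gcd(a, m), the factor m / g annihilates `a` modulo `m`, hence also `b`; so g divides
-- `b`, and Bézout makes g a multiple of `a` modulo `m`. This is the cyclicity used in `saturate`.
order-divides⇒multiple : ∀ m a b → m ≢ 0 → (∀ N → + m ∣ N ℤ.* a → + m ∣ N ℤ.* b) → Σ ℤ λ t → + m ∣ b ℤ.- t ℤ.* a
order-divides⇒multiple m a b m≢0 ord with bézout m a
... | g , divides a′ a≡ , divides n m≡ , x , y , g≡ = b′ ℤ.* x , divides (b′ ℤ.* y) b-eq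
  where
  n≢0 : n ≢ 0ℤ
  n≢0 refl = m≢0 (ℤₚ.+-injective m≡)
  instance _ = ℤ.≢-nonZero n≢0
  comm₃ : ∀ n a g → n ℤ.* (a ℤ.* g) ≡ a ℤ.* (n ℤ.* g)
  comm₃ = solve-∀
  m∣na : + m ∣ n ℤ.* a
  m∣na = divides a′ (trans (cong (n ℤ.*_) a≡) (trans (comm₃ n a′ g) (cong (a′ ℤ.*_) (sym m≡))))
  g∣b : g ∣ b
  g∣b = *-cancelˡ-∣ n (subst (_∣ n ℤ.* b) m≡ (ord n m∣na))
  b′ = quotient g∣b
  expand : ∀ b x a y m → b ℤ.* (x ℤ.* a ℤ.+ y ℤ.* m) ℤ.- b ℤ.* x ℤ.* a ≡ b ℤ.* y ℤ.* m
  expand = solve-∀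
  b-eq : b ℤ.- b′ ℤ.* x ℤ.* a ≡ b′ ℤ.* y ℤ.* + m
  b-eq = trans (cong (λ z → z ℤ.- b′ ℤ.* x ℤ.* a) (trans (_∣_.equality g∣b) (cong (b′ ℤ.*_) g≡))) (expand b′ x a y (+ m))

remove : ∀ {A : Set} {x : A} {xs} → x ∈ xs → Σ (List A) λ ys → (length xs ≡ suc (length ys)) × (∀ {y} → y ∈ xs → y ≡ x ⊎ y ∈ ys)
remove {xs = _ ∷ xs} (here refl) = xs , refl , λ { (here e) → inj₁ e ; (there p) → inj₂ p }
remove {xs = z ∷ xs} (there p) with remove p
... | ys , len , split = z ∷ ys , cong suc len , λ { (here e) → inj₂ (here e) ; (there q) → [ inj₁ , inj₂ ∘ there ]′ (split q) }

-- Runs, Nerode equivalence and periods of states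

module Automaton {A : List ℕ} (D : Desc A) (isDFA : IsEquivariantDFA D) where
  open Desc D public hiding (trans)
  open IsEquivariantDFA isDFA public
  open Points states public
  module L = Points A

  infixl 8 _·_
  _·_ : State D → ℤ → State D
  q · z = actE states z q

  δ : State D → Letter D → State D
  δ q a = proj₁ (total q a)

  δ-Δ : ∀ q a → Δ D q a (δ q a)
  δ-Δ q a = proj₂ (total q a)

  δ-unique : ∀ {q a r} → Δ D q a r → δ q a ≡ r
  δ-unique t = functional _ _ _ _ (δ-Δ _ _) t

  δ-· : ∀ q a z → δ (q · z) (actE A z a) ≡ δ q a · z
  δ-· q a z = δ-unique (δ-equiv z q a _ (δ-Δ q a))

  run : State D → Word D → State D
  run q []      = q
  run q (a ∷ w) = run (δ q a) w

  run-· : ∀ q w z → run (q · z) (List.map (actE A z) w) ≡ run q w · z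
  run-· q []      z = refl
  run-· q (a ∷ w) z = trans (cong (λ q → run q (List.map (actE A z) w)) (δ-· q a z)) (run-· (δ q a) w z)

  run-++ : ∀ q u v → run q (u List.++ v) ≡ run (run q u) v
  run-++ q []      v = refl
  run-++ q (a ∷ u) v = run-++ (δ q a) u v

  acc : State D → Bool
  acc q = final (orbit states q)

  accepts : State D → Word D → Bool
  accepts q w = acc (run q w)

  Run-run : ∀ q w → Run D q w (run q w)
  Run-run q []      = done
  Run-run q (a ∷ w) = step (δ-Δ q a) (Run-run (δ q a) w)

  Run-unique : ∀ {q w r} → Run D q w r → run q w ≡ r
  Run-unique done = refl
  Run-unique {w = _ ∷ w} (step t r) = trans (cong (λ q → run q w) (δ-unique t)) (Run-unique r)

  LangFrom-accepts : ∀ q w → LangFrom D q w ⟺ (accepts q w ≡ true)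
  LangFrom-accepts q w = (λ (r , t , p) → trans (cong acc (Run-unique t)) p) , (λ p → run q w , Run-run q w , p)

  infix 4 _~_
  -- A record instead of a function type, so that both states can be recovered from a proof although
  -- `accepts` unfolds.
  record _~_ (q r : State D) : Set where
    constructor mk~
    field on : ∀ w → accepts q w ≡ accepts r w
  open _~_ public

  ~-refl : ∀ {q} → q ~ q
  ~-refl = mk~ λ w → refl

  ~-reflexive : ∀ {q r} → q ≡ r → q ~ r
  ~-reflexive refl = ~-refl

  ~-sym : ∀ {q r} → q ~ r → r ~ q
  ~-sym e = mk~ λ w → sym (on e w)

  ~-trans : ∀ {q r s} → q ~ r → r ~ s → q ~ s
  ~-trans e f = mk~ λ w → trans (on e w) (on f w)

  ~-δ : ∀ {q r} → q ~ r → ∀ a → δ q a ~ δ r a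
  ~-δ e a = mk~ λ w → on e (a ∷ w)

  accepts-· : ∀ q w z → accepts (q · z) w ≡ accepts q (List.map (actE A (ℤ.- z)) w)
  accepts-· q w z = cong (final ∘ orbit states) (trans (cong (run (q · z)) (sym back)) (run-· q (List.map (actE A (ℤ.- z)) w) z))
    where
    back : List.map (actE A z) (List.map (actE A (ℤ.- z)) w) ≡ w
    back = trans (sym (Listₚ.map-∘ w)) (trans (Listₚ.map-cong (λ a → trans (L.actE-+ (ℤ.- z) z a)
             (trans (cong (λ y → actE A y a) (ℤₚ.+-inverseˡ z)) (L.actE-0 a))) w) (Listₚ.map-id w))

  ~-· : ∀ {q r} → q ~ r → ∀ z → q · z ~ r · z
  ~-· {q} {r} e z = mk~ λ w → trans (accepts-· q w z) (trans (on e (List.map (actE A (ℤ.- z)) w)) (sym (accepts-· r w z)))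

  ·-+ : ∀ q y z → q · y · z ≡ q · (y ℤ.+ z)
  ·-+ q y z = actE-+ y z q

  Per : State D → ℤ → Set
  Per q z = q · z ~ q

  Per-0 : ∀ {q} → Per q 0ℤ
  Per-0 {q} = ~-reflexive (actE-0 q)

  Per-+ : ∀ {q y z} → Per q y → Per q z → Per q (y ℤ.+ z)
  Per-+ {q} {y} {z} p r = ~-trans (~-reflexive (sym (·-+ q y z))) (~-trans (~-· p z) r)

  Per-neg : ∀ {q z} → Per q z → Per q (ℤ.- z)
  Per-neg {q} {z} p = ~-trans (~-· (~-sym p) (ℤ.- z)) (~-reflexive (trans (·-+ q z (ℤ.- z)) (trans (cong (q ·_) (ℤₚ.+-inverseʳ z)) (actE-0 q))))

  -- Translations commute, so all states of an orbit have the same periods.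
  Per-shift : ∀ {q} y {z} → Per q z → Per (q · y) z
  Per-shift {q} y {z} p = ~-trans (~-reflexive (trans (·-+ q y z) (trans (cong (q ·_) (ℤₚ.+-comm y z)) (sym (·-+ q z y))))) (~-· p y)

  Per-* : ∀ {q z} n → Per q z → Per q (n ℤ.* z)
  Per-* {q} {z} (+ n) p = go n
    where
    go : ∀ n → Per q (+ n ℤ.* z)
    go zero    = subst (Per q) (sym (ℤₚ.*-zeroˡ z)) Per-0
    go (suc n) = subst (Per q) (sym (ℤₚ.suc-* (+ n) z)) (Per-+ p (go n))
  Per-* {q} {z} -[1+ n ] p = subst (Per q) (ℤₚ.neg-distribˡ-* (+ suc n) z) (Per-neg (Per-* (+ suc n) p))

  Per⇒~ : ∀ {q y z} → Per q (y ℤ.- z) → q · y ~ q · z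
  Per⇒~ {q} {y} {z} p = ~-trans (~-reflexive (trans (cong (q ·_) (sym (lem y z))) (sym (·-+ q (y ℤ.- z) z)))) (~-· p z)
    where lem : ∀ y z → y ℤ.- z ℤ.+ z ≡ y
          lem = solve-∀

  ~⇒Per : ∀ {q y z} → q · y ~ q · z → Per q (y ℤ.- z)
  ~⇒Per {q} {y} {z} e = ~-trans (~-reflexive (sym (·-+ q y (ℤ.- z)))) (~-trans (~-· e (ℤ.- z))
     (~-reflexive (trans (·-+ q z (ℤ.- z)) (trans (cong (q ·_) (ℤₚ.+-inverseʳ z)) (actE-0 q)))))

  same-orbit : ∀ {q r} → orbit states q ≡ orbit states r → r ≡ q · (repE states r ℤ.- repE states q)
  same-orbit {q} {r} eq = trans (sym (pt-rep r)) (trans (cong₂ pt (sym eq) (sym (lem (repE states q) (repE states r)))) (sym (actE-rep _ q)))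
    where lem : ∀ x y → x ℤ.+ (y ℤ.- x) ≡ y
          lem = solve-∀

  -- `tail` is what eventual affinity of `δ` will provide. `μ` gives a generator of each orbit's
  -- group of periods, 0 if that group is trivial; so `Finite q` means that `q` has a nonzero
  -- period.
  module Bounded (P : ℤ)
    (tail : ∀ q m → m ≢ 0ℤ → Per q m → ∀ a → Σ ℤ λ c → ∀ u → δ (q · (P ℤ.* u)) a ~ δ q a · (c ℤ.* u))
    (μ : Orb → ℕ) (per : ∀ q z → Per q z ⟺ (+ μ (orbit states q) ∣ z)) where

    Finite : State D → Set
    Finite q = μ (orbit states q) ≢ 0

    private
      instance-per : ∀ q → Per q (+ μ (orbit states q))
      instance-per q = proj₂ (per q _) ∣-refl

    slope : ∀ q → Finite q → ∀ a → Σ ℤ λ c → ∀ u → δ (q · (P ℤ.* u)) a ~ δ q a · (c ℤ.* u)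
    slope q fin = tail q _ (fin ∘ ℤₚ.+-injective) (instance-per q)

    -- Translating `q` by `P * m₀` changes nothing up to `~`, yet it moves the successor by
    -- `c * m₀`. This is therefore a period of the successor, and nonzero if `c` is.
    slope-finite : ∀ q (fin : Finite q) a → proj₁ (slope q fin a) ≢ 0ℤ → Finite (δ q a)
    slope-finite q fin a c≢0 eq = [ c≢0 , fin ∘ ℤₚ.+-injective ]′ (ℤₚ.i*j≡0⇒i≡0∨j≡0 c (0∣⇒≡0 (subst (λ m → + m ∣ c ℤ.* + m₀) eq (proj₁ (per _ _) p))))
      where
      c = proj₁ (slope q fin a)
      m₀ = μ (orbit states q)
      p : Per (δ q a) (c ℤ.* + m₀)
      p = ~-trans (~-sym (proj₂ (slope q fin a) (+ m₀))) (~-δ (Per-* P (instance-per q)) a)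

    Divisible : State D → ℤ → Set
    Divisible q z = Σ ℤ λ u → Per q (z ℤ.- P ℤ.* u)

    -- The displacement z stays divisible by P, modulo periods, along all runs of length k from q.
    B : ℕ → State D → ℤ → Set
    B zero    q z = Divisible q z
    B (suc k) q z = Divisible q z × (∀ a z′ → δ (q · z) a ~ δ q a · z′ → B k (δ q a) z′)

    B-divisible : ∀ k {q z} → B k q z → Divisible q z
    B-divisible zero    b = b
    B-divisible (suc k) b = proj₁ b

    B-mono : ∀ k {q z} → B (suc k) q z → B k q z
    B-mono zero    b = proj₁ b
    B-mono (suc k) b = proj₁ b , λ a z′ e → B-mono k (proj₂ b a z′ e)

    B-resp : ∀ k {q y z} → Per q (y ℤ.- z) → B k q y → B k q z
    B-resp k {q} {y} {z} p b = go k b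
      where
      lem : ∀ y z u → ℤ.- (y ℤ.- z) ℤ.+ (y ℤ.- u) ≡ z ℤ.- u
      lem = solve-∀
      div : Divisible q y → Divisible q z
      div (u , h) = u , subst (Per q) (lem y z (P ℤ.* u)) (Per-+ (Per-neg p) h)
      go : ∀ k → B k q y → B k q z
      go zero    d = div d
      go (suc k) (d , f) = div d , λ a z′ e → f a z′ (~-trans (~-δ (Per⇒~ p) a) e)

    B-Per : ∀ k {q z} → Per q z → B k q z
    B-Per k {q} {z} p = go k
      where
      lem : ∀ z p → z ℤ.- p ℤ.* 0ℤ ≡ z
      lem = solve-∀
      div : Divisible q z
      div = 0ℤ , subst (Per q) (sym (lem z P)) p
      go : ∀ k → B k q z
      go zero    = div
      go (suc k) = div , λ a z′ e → B-Per k (~-trans (~-sym e) (~-δ p a))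

    -- A run from `q · y` is the translate of a run from `q` over letters moved back by `y`, and
    -- translations commute; hence survival depends only on the orbit.
    B-shift : ∀ k {q z} y → B k q z → B k (q · y) z
    B-shift k {q} {z} y b = go k b
      where
      div : Divisible q z → Divisible (q · y) z
      div (u , h) = u , Per-shift y h
      go : ∀ k → B k q z → B k (q · y) z
      go zero    d = div d
      go (suc k) (d , f) = div d , λ a z′ e →
        let b = actE A (ℤ.- y) a
            a≡ : actE A y b ≡ a
            a≡ = trans (L.actE-+ (ℤ.- y) y a) (trans (cong (λ y → actE A y a) (ℤₚ.+-inverseˡ y)) (L.actE-0 a))
            δ≡ : ∀ r → δ (r · y) a ≡ δ r b · y
            δ≡ r = trans (cong (δ (r · y)) (sym a≡)) (δ-· r b y)
            swap : ∀ r s t → r · s · t ≡ r · t · s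
            swap r s t = trans (·-+ r s t) (trans (cong (r ·_) (ℤₚ.+-comm s t)) (sym (·-+ r t s)))
            e₁ : δ (q · z) b · y ~ δ q b · z′ · y
            e₁ = ~-trans (~-reflexive (trans (sym (δ≡ (q · z))) (cong (λ r → δ r a) (swap q z y))))
                   (~-trans e (~-reflexive (trans (cong (_· z′) (δ≡ q)) (swap (δ q b) y z′))))
            back : ∀ r → r · y · (ℤ.- y) ≡ r
            back r = trans (·-+ r y (ℤ.- y)) (trans (cong (r ·_) (ℤₚ.+-inverseʳ y)) (actE-0 r))
            e₂ : δ (q · z) b ~ δ q b · z′
            e₂ = subst₂ _~_ (back _) (back _) (~-· e₁ (ℤ.- y))
        in subst (λ r → B k r z′) (sym (δ≡ q)) (B-shift k y (f b z′ e₂))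

    successor : ∀ q (fin : Finite q) z ((u , h) : Divisible q z) a → δ (q · z) a ~ δ q a · (proj₁ (slope q fin a) ℤ.* u)
    successor q fin z (u , h) a = ~-trans (~-δ (Per⇒~ h) a) (proj₂ (slope q fin a) u)

    -- Either the translation of q is forgotten after reading a, or the successor is finite again.
    successor-B : ∀ k q (fin : Finite q) z (d : Divisible q z) a z′ → δ (q · z) a ~ δ q a · z′ →
      (Finite (δ q a) → B k (δ q a) (proj₁ (slope q fin a) ℤ.* proj₁ d)) → B k (δ q a) z′
    successor-B k q fin z d a z′ e b = go (proj₁ (slope q fin a) ℤ.≟ 0ℤ)
      where
      c = proj₁ (slope q fin a)
      p : Per (δ q a) (c ℤ.* proj₁ d ℤ.- z′)
      p = ~⇒Per (~-trans (~-sym (successor q fin z d a)) e)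
      lem : ∀ u z → ℤ.- (0ℤ ℤ.* u ℤ.- z) ≡ z
      lem = solve-∀
      go : Dec (c ≡ 0ℤ) → B k (δ q a) z′
      go (yes c≡0) = B-Per k (subst (Per (δ q a)) (trans (cong (λ c → ℤ.- (c ℤ.* proj₁ d ℤ.- z′)) c≡0) (lem (proj₁ d) z′)) (Per-neg p))
      go (no c≢0)  = B-resp k p (b (slope-finite q fin a c≢0))

    -- If `z` passes to `c * u`, then `t * z` passes to `t * (c * u)`, so a multiple survives as
    -- long as `z` does. Other choices of the next displacement differ by a period and are handled
    -- by `successor-B`.
    B-* : ∀ k t {q z} → Finite q → B k q z → B k q (t ℤ.* z)
    B-* k t {q} {z} fin b = go k b
      where
      lem : ∀ t z p u → t ℤ.* (z ℤ.- p ℤ.* u) ≡ t ℤ.* z ℤ.- p ℤ.* (t ℤ.* u)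
      lem = solve-∀
      comm : ∀ t c u → t ℤ.* (c ℤ.* u) ≡ c ℤ.* (t ℤ.* u)
      comm = solve-∀
      div : Divisible q z → Divisible q (t ℤ.* z)
      div (u , h) = t ℤ.* u , subst (Per q) (lem t z P u) (Per-* t h)
      go : ∀ k → B k q z → B k q (t ℤ.* z)
      go zero    d = div d
      go (suc k) (d , f) = div d , λ a z′ e → successor-B k q fin (t ℤ.* z) (div d) a z′ e
        λ fin′ → subst (B k (δ q a)) (comm t (proj₁ (slope q fin a)) (proj₁ d)) (B-* k t fin′ (f a _ (successor q fin z d a)))

    -- Each letter replaces one factor `P` by a slope, and `B-*` absorbs the slope. The extra factor
    -- pays for the divisibility still required after the last letter.
    B-power : ∀ k {q} → Finite q → B k q (P ℤ.^ suc k)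
    B-power k {q} fin = go k
      where
      lem : ∀ y → y ℤ.- y ≡ 0ℤ
      lem = solve-∀
      div : ∀ k → Divisible q (P ℤ.^ suc k)
      div k = P ℤ.^ k , subst (Per q) (sym (lem (P ℤ.^ suc k))) Per-0
      go : ∀ k → B k q (P ℤ.^ suc k)
      go zero    = div 0
      go (suc k) = div (suc k) , λ a z′ e → successor-B k q fin _ (div (suc k)) a z′ e
        λ fin′ → B-* k (proj₁ (slope q fin a)) fin′ (B-power k fin′)

    -- Orbit o was visited before reaching (q , z), at a pair that survives k + 1 more steps.
    Visited : ℕ → State D → ℤ → Orb → Set
    Visited k q z o = Σ (State D) λ q₀ → Σ ℤ λ z₀ → (orbit states q₀ ≡ o) × B (suc k) q₀ z₀ × (∀ N → Per q₀ (N ℤ.* z₀) → Per q (N ℤ.* z))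

    -- On a return to a visited orbit, cyclicity makes z a multiple of the earlier displacement, which survives long enough.
    saturate : ∀ k (L : List Orb) → length L ≡ k → ∀ q z → Finite q →
      (∀ o → o ∈ L ⊎ Visited k q z o) → B k q z → B (suc k) q z
    saturate k L len q z fin cover b with cover (orbit states q)
    ... | inj₂ (q₀ , z₀ , o≡ , b₀ , ord) =
      let m = μ (orbit states q)
          ord′ : ∀ N → + m ∣ N ℤ.* z₀ → + m ∣ N ℤ.* z
          ord′ N d = proj₁ (per q _) (ord N (proj₂ (per q₀ _) (subst (λ o → + μ o ∣ N ℤ.* z₀) (sym o≡) d)))
          t , m∣ = order-divides⇒multiple m z₀ z fin ord′
          bq = subst (λ r → B (suc k) r z₀) (sym (same-orbit {q₀} {q} o≡)) (B-shift (suc k) _ b₀)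
      in B-resp (suc k) (subst (Per q) (neg-diff z (t ℤ.* z₀)) (Per-neg (proj₂ (per q _) m∣))) (B-* (suc k) t fin bq)
      where
      neg-diff : ∀ a b → ℤ.- (a ℤ.- b) ≡ b ℤ.- a
      neg-diff = solve-∀
    saturate zero [] len q z fin cover b | inj₁ ()
    saturate zero (_ ∷ _) () q z fin cover b | inj₁ _
    saturate (suc k) L len q z fin cover b@(d , f) | inj₁ o∈L with remove o∈L
    ... | L′ , len′ , split = d , λ a z′ e → next a z′ e
      where
      next : ∀ a z′ → δ (q · z) a ~ δ q a · z′ → B (suc k) (δ q a) z′
      next a z′ e = successor-B (suc k) q fin z d a z′ e λ fin′ → saturate k L′ (ℕₚ.suc-injective (trans (sym len′) len)) (δ q a) w fin′ cover′ (f a w ew)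
        where
        u = proj₁ d
        c = proj₁ (slope q fin a)
        w = c ℤ.* u
        ew = successor q fin z d a
        lem : ∀ N z p u → N ℤ.* (z ℤ.- p ℤ.* u) ≡ N ℤ.* z ℤ.- p ℤ.* (N ℤ.* u)
        lem = solve-∀
        comm : ∀ c N u → c ℤ.* (N ℤ.* u) ≡ N ℤ.* (c ℤ.* u)
        comm = solve-∀
        order : ∀ N → Per q (N ℤ.* z) → Per (δ q a) (N ℤ.* w)
        order N p = subst (Per (δ q a)) (comm c N u) (~-trans (~-sym (successor q fin (N ℤ.* z)
                      (N ℤ.* u , subst (Per q) (lem N z P u) (Per-* N (proj₂ d))) a)) (~-δ p a))
        cover′ : ∀ o → o ∈ L′ ⊎ Visited k (δ q a) w o
        cover′ o with cover o
        ... | inj₂ (q₀ , z₀ , o≡ , b₀ , ord) = inj₂ (q₀ , z₀ , o≡ , B-mono (suc k) b₀ , λ N → order N ∘ ord N)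
        ... | inj₁ o∈L with split o∈L
        ...   | inj₂ o∈L′ = inj₁ o∈L′
        -- `B (suc k)` is exactly what `Visited k` asks for: the horizon drops together with the
        -- number of unvisited orbits.
        ...   | inj₁ refl = inj₂ (q , z , refl , b , order)

    private n = length states

    -- At the start no orbit is visited, so the horizon has to be the number `n` of all orbits;
    -- through `B-power` this gives the exponent `suc n` of the bound.
    B-saturated : ∀ {q z} → Finite q → B n q z → B (suc n) q z
    B-saturated fin = saturate n (allFin n) (Listₚ.length-tabulate id) _ _ fin (λ o → inj₁ (∈-allFin o))

    -- By saturation `B n` passes to the successor pair and never runs out. The two runs stay
    -- translates of each other up to `~`, unless a slope 0 makes them equivalent, and acceptance
    -- depends on the orbit only.
    B⇒Per : ∀ {q z} → Finite q → B n q z → Per q z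
    B⇒Per {q} {z} fin b = mk~ λ w → go w q z fin b
      where
      go : ∀ w q z → Finite q → B n q z → accepts (q · z) w ≡ accepts q w
      go []      q z fin b = refl
      go (a ∷ w) q z fin b = trans (on (successor q fin z d a) w) (next (c ℤ.≟ 0ℤ))
        where
        d = B-divisible n b
        c = proj₁ (slope q fin a)
        next : Dec (c ≡ 0ℤ) → accepts (δ q a · (c ℤ.* proj₁ d)) w ≡ accepts (δ q a) w
        next (yes c≡0) = on (subst (Per (δ q a)) (sym (cong (ℤ._* proj₁ d) c≡0)) (subst (Per (δ q a)) (sym (ℤₚ.*-zeroˡ (proj₁ d))) Per-0)) w
        next (no c≢0)  = go w (δ q a) _ (slope-finite q fin a c≢0)
          (proj₂ (B-saturated fin b) a _ (successor q fin z d a))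

    period-bound : ∀ i → μ i ≢ 0 → + μ i ∣ P ℤ.^ suc n
    period-bound i fin = proj₁ (per (pt i 0ℤ) _) (B⇒Per fin (B-power n fin))

-- Eventual affinity of the transition function

ray : ∀ {n} → Env n → Env n → ℕ → Env n
ray ρ v t i = ρ i ℤ.+ + t ℤ.* v i

slopeTerm : ∀ {n} → Term n → Env n → ℤ
slopeTerm (var i) v = v i
slopeTerm (con c) v = 0ℤ
slopeTerm (s ⊕ t) v = slopeTerm s v ℤ.+ slopeTerm t v
slopeTerm (c ⊛ t) v = c ℤ.* slopeTerm t v

term-ray : ∀ {n} (T : Term n) ρ v t → ⟦ T ⟧t (ray ρ v t) ≡ ⟦ T ⟧t ρ ℤ.+ + t ℤ.* slopeTerm T v
term-ray (var i) ρ v t = refl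
term-ray (con c) ρ v t = sym (trans (cong (λ z → c ℤ.+ z) (ℤₚ.*-zeroʳ (+ t))) (ℤₚ.+-identityʳ c))
term-ray (S ⊕ T) ρ v t = trans (cong₂ ℤ._+_ (term-ray S ρ v t) (term-ray T ρ v t)) (lem (⟦ S ⟧t ρ) (⟦ T ⟧t ρ) (+ t) (slopeTerm S v) (slopeTerm T v))
  where lem : ∀ a b t x y → (a ℤ.+ t ℤ.* x) ℤ.+ (b ℤ.+ t ℤ.* y) ≡ (a ℤ.+ b) ℤ.+ t ℤ.* (x ℤ.+ y)
        lem = solve-∀
term-ray (c ⊛ T) ρ v t = trans (cong (c ℤ.*_) (term-ray T ρ v t)) (lem c (⟦ T ⟧t ρ) (+ t) (slopeTerm T v))
  where lem : ∀ c a t x → c ℤ.* (a ℤ.+ t ℤ.* x) ≡ c ℤ.* a ℤ.+ t ℤ.* (c ℤ.* x)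
        lem = solve-∀

slopeTerm-∣ : ∀ {n d} (T : Term n) v → (∀ i → d ∣ v i) → d ∣ slopeTerm T v
slopeTerm-∣ (var i) v p = p i
slopeTerm-∣ (con c) v p = divides 0ℤ refl
slopeTerm-∣ (S ⊕ T) v p = ∣m∣n⇒∣m+n (slopeTerm-∣ S v p) (slopeTerm-∣ T v p)
slopeTerm-∣ (c ⊛ T) v p = ∣n⇒∣m*n c (slopeTerm-∣ T v p)

EventuallyConstant : (ℕ → Set) → Set
EventuallyConstant P = Σ ℕ λ N → (∀ t → N ℕ.≤ t → P t) ⊎ (∀ t → N ℕ.≤ t → ¬ P t)

private
  always : ∀ {P : ℕ → Set} {A : Set} → Dec A → (∀ t → A ⟺ P t) → EventuallyConstant P
  always (yes a) e = 0 , inj₁ (λ t _ → proj₁ (e t) a)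
  always (no ¬a) e = 0 , inj₂ (λ t _ → ¬a ∘ proj₂ (e t))

  a≤∣a∣ : ∀ a → a ℤ.≤ + ∣ a ∣
  a≤∣a∣ (+ n)    = ℤₚ.≤-refl
  a≤∣a∣ -[1+ n ] = ℤ.-≤+

  -∣a∣≤a : ∀ a → ℤ.- + ∣ a ∣ ℤ.≤ a
  -∣a∣≤a a = subst (ℤ.- + ∣ a ∣ ℤ.≤_) (ℤₚ.neg-involutive a)
    (ℤₚ.neg-mono-≤ (subst (λ z → ℤ.- a ℤ.≤ + z) (ℤₚ.∣-i∣≡∣i∣ a) (a≤∣a∣ (ℤ.- a))))

  neg-absorb : ∀ (a b : ℤ) t → ∣ a ∣ ℕ.≤ t → b ℤ.≤ ℤ.- + 1 → a ℤ.+ + t ℤ.* b ℤ.≤ 0ℤ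
  neg-absorb a b t a≤t b≤ = ℤₚ.≤-trans
    (ℤₚ.+-mono-≤ (ℤₚ.≤-trans (a≤∣a∣ a) (ℤ.+≤+ a≤t)) (ℤₚ.*-monoˡ-≤-nonNeg (+ t) b≤)) (ℤₚ.≤-reflexive (lem (+ t)))
    where lem : ∀ t → t ℤ.+ t ℤ.* ℤ.- + 1 ≡ 0ℤ
          lem = solve-∀

  pos-absorb : ∀ (a b : ℤ) t → suc ∣ a ∣ ℕ.≤ t → + 1 ℤ.≤ b → ¬ (a ℤ.+ + t ℤ.* b ℤ.≤ 0ℤ)
  pos-absorb a b t a<t 1≤b le0 = ℕₚ.<⇒≱ a<t (ℤₚ.drop‿+≤+ (ℤₚ.i-j≤0⇒i≤j
    (subst (ℤ._≤ 0ℤ) (lem (+ t) (+ ∣ a ∣)) (ℤₚ.≤-trans (ℤₚ.+-mono-≤ (-∣a∣≤a a) (ℤₚ.*-monoˡ-≤-nonNeg (+ t) 1≤b)) le0))))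
    where lem : ∀ t a → ℤ.- a ℤ.+ t ℤ.* + 1 ≡ t ℤ.- a
          lem = solve-∀

  linear-constant : ∀ a b → EventuallyConstant (λ t → a ℤ.+ + t ℤ.* b ℤ.≤ 0ℤ)
  linear-constant a (+ 0) = always (a ℤ.≤? 0ℤ) (λ t → ≡⇒⟺ (cong (ℤ._≤ 0ℤ) (sym (trans (cong (λ z → a ℤ.+ z) (ℤₚ.*-zeroʳ (+ t))) (ℤₚ.+-identityʳ a)))))
  linear-constant a b@(+ suc _) = suc ∣ a ∣ , inj₂ (λ t p → pos-absorb a b t p (ℤ.+≤+ (ℕ.s≤s ℕ.z≤n)))
  linear-constant a b@(-[1+ _ ]) = ∣ a ∣ , inj₁ (λ t p → neg-absorb a b t p (ℤ.-≤- ℕ.z≤n))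

-- A direction divisible by the period leaves every `dv` atom constant from the start; a `le` atom
-- is affine in `t`, so its sign settles.
eventually-constant : ∀ {n} (φ : QF n) ρ v → (∀ i → + period φ ∣ v i) → EventuallyConstant (λ t → Sat φ (ray ρ v t))
eventually-constant (le T) ρ v p with linear-constant (⟦ T ⟧t ρ) (slopeTerm T v)
... | N , inj₁ f = N , inj₁ (λ t q → subst (ℤ._≤ 0ℤ) (sym (term-ray T ρ v t)) (f t q))
... | N , inj₂ f = N , inj₂ (λ t q → f t q ∘ subst (ℤ._≤ 0ℤ) (term-ray T ρ v t))
eventually-constant (dv d T) ρ v p = always (+ suc d ∣? ⟦ T ⟧t ρ) λ t →
  let d∣ = ∣n⇒∣m*n (+ t) (slopeTerm-∣ T v p) in
  (λ q → subst (+ suc d ∣_) (sym (term-ray T ρ v t)) (∣m∣n⇒∣m+n q d∣)) ,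
  (λ q → ∣m+n∣n⇒∣m (subst (+ suc d ∣_) (term-ray T ρ v t) q) d∣)
eventually-constant (no′ φ) ρ v p with eventually-constant φ ρ v p
... | N , inj₁ f = N , inj₂ (λ t q ¬s → ¬s (f t q))
... | N , inj₂ f = N , inj₁ f
eventually-constant (an φ ψ) ρ v p
  with eventually-constant φ ρ v (λ i → ∣-trans (m∣mn (period φ) (period ψ)) (p i))
     | eventually-constant ψ ρ v (λ i → ∣-trans (n∣mn (period φ) (period ψ)) (p i))
... | N , inj₂ f | _          = N , inj₂ (λ t q → f t q ∘ proj₁)
... | _          | M , inj₂ g = M , inj₂ (λ t q → g t q ∘ proj₂)
... | N , inj₁ f | M , inj₁ g = N ℕ.⊔ M , inj₁ (λ t q → f t (ℕₚ.m⊔n≤o⇒m≤o N M q) , g t (ℕₚ.m⊔n≤o⇒n≤o N M q))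
eventually-constant (or φ ψ) ρ v p
  with eventually-constant φ ρ v (λ i → ∣-trans (m∣mn (period φ) (period ψ)) (p i))
     | eventually-constant ψ ρ v (λ i → ∣-trans (n∣mn (period φ) (period ψ)) (p i))
... | N , inj₁ f | _          = N , inj₁ (λ t q → inj₁ (f t q))
... | _          | M , inj₁ g = M , inj₁ (λ t q → inj₂ (g t q))
... | N , inj₂ f | M , inj₂ g = N ℕ.⊔ M , inj₂ (λ t q → [ f t (ℕₚ.m⊔n≤o⇒m≤o N M q) , g t (ℕₚ.m⊔n≤o⇒n≤o N M q) ]′)

StableFrom : ℕ → (ℕ → Set) → Set
StableFrom N P = P N → ∀ t → N ℕ.≤ t → P t

stable : ∀ {P} (e : EventuallyConstant P) {M} → proj₁ e ℕ.≤ M → StableFrom M P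
stable (N , inj₁ f) N≤M p t M≤t = f t (ℕₚ.≤-trans N≤M M≤t)
stable (N , inj₂ f) N≤M p t M≤t = contradiction p (f _ N≤M)

maximum : ∀ {m} → (Fin m → ℕ) → ℕ
maximum {zero}  f = 0
maximum {suc m} f = f Fin.zero ℕ.⊔ maximum (f ∘ Fin.suc)

≤-maximum : ∀ {m} (f : Fin m → ℕ) i → f i ℕ.≤ maximum f
≤-maximum f Fin.zero    = ℕₚ.m≤m⊔n (f Fin.zero) _
≤-maximum f (Fin.suc i) = ℕₚ.m≤n⇒m≤o⊔n (f Fin.zero) (≤-maximum (f ∘ Fin.suc) i)

∏ : ∀ {m} → (Fin m → ℕ) → ℕ
∏ f = product (tabulate f)

∏≢0 : ∀ {m} (f : Fin m → ℕ) → (∀ i → ℕ.NonZero (f i)) → ℕ.NonZero (∏ f)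
∏≢0 f nz = product≢0 (Allₚ.tabulate⁺ nz)

∣∏ : ∀ {m} (f : Fin m → ℕ) i → f i ℕᵈ.∣ ∏ f
∣∏ f i = ∈⇒∣product (∈-tabulate⁺ i)

-- The slope is `σ / (k + 1)`. Expressing it by two consecutive values of `f` avoids division and
-- shows that it is an integer.
affine : ∀ k N T σ (f : ∀ t → N ℕ.≤ t → ℤ) → (∀ t t≥ → + suc k ℤ.* f t t≥ ≡ T ℤ.+ + t ℤ.* σ) →
  ∀ t t≥ → f t t≥ ≡ f N ℕₚ.≤-refl ℤ.+ (+ t ℤ.- + N) ℤ.* (f (suc N) (ℕₚ.n≤1+n N) ℤ.- f N ℕₚ.≤-refl)
affine k N T σ f eq t t≥ = ℤₚ.*-cancelˡ-≡ (+ suc k) _ _ (trans (eq t t≥) (sym (trans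
    (expand (+ suc k) s₀ s₁ (+ t ℤ.- + N))
    (trans (cong₂ (λ a b → a ℤ.+ (+ t ℤ.- + N) ℤ.* (b ℤ.- a)) (eq N ℕₚ.≤-refl) (eq (suc N) (ℕₚ.n≤1+n N)))
           (collect T (+ N) (+ t) σ)))))
  where
  s₀ = f N ℕₚ.≤-refl
  s₁ = f (suc N) (ℕₚ.n≤1+n N)
  expand : ∀ k a b d → k ℤ.* (a ℤ.+ d ℤ.* (b ℤ.- a)) ≡ k ℤ.* a ℤ.+ d ℤ.* (k ℤ.* b ℤ.- k ℤ.* a)
  expand = solve-∀
  collect : ∀ T N t σ → (T ℤ.+ N ℤ.* σ) ℤ.+ (t ℤ.- N) ℤ.* ((T ℤ.+ (+ 1 ℤ.+ N) ℤ.* σ) ℤ.- (T ℤ.+ N ℤ.* σ)) ≡ T ℤ.+ t ℤ.* σ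
  collect = solve-∀

module Affine {A : List ℕ} (D : Desc A) (isDFA : IsEquivariantDFA D) where
  open Automaton D isDFA

  -- Since q ~ q · m, a letter can be moved arbitrarily far away from q, where δ is affine.
  module _ (P : ℤ) (q : State D) (a : Letter D) (N : ℕ) (σ : ℤ)
    (eventually : ∀ t → N ℕ.≤ t → δ q (actE A (+ t ℤ.* P) a) ≡ δ q (actE A (+ N ℤ.* P) a) · ((+ t ℤ.- + N) ℤ.* σ))
    (m : ℤ) (m≢0 : m ≢ 0ℤ) (p : Per q m) where
    private
      f : ℤ → State D
      f z = δ q (actE A z a)

      δ-moved : ∀ z → δ (q · z) a ≡ f (ℤ.- z) · z
      δ-moved z = trans (cong (δ (q · z)) (sym (trans (L.actE-+ (ℤ.- z) z a) (trans (cong (λ y → actE A y a) (ℤₚ.+-inverseˡ z)) (L.actE-0 a)))))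
                        (δ-· q _ z)

      f-moved : ∀ M z → Per q M → f z ~ f (z ℤ.+ M) · (ℤ.- M)
      f-moved M z pM = ~-trans (~-δ (~-sym (Per-neg pM)) (actE A z a)) (~-reflexive
        (trans (cong (δ (q · (ℤ.- M))) (sym (trans (cong (actE A (ℤ.- M)) (sym (L.actE-+ z M a)))
           (trans (L.actE-+ M (ℤ.- M) _) (trans (cong (λ y → actE A y (actE A z a)) (ℤₚ.+-inverseʳ M)) (L.actE-0 _))))))
           (δ-· q _ (ℤ.- M))))

    -- Moving `q` by `P * u` amounts to moving the letter by `- (P * u)` and the result by `P * u`.
    -- The letter's move contributes `- (σ * u)`, whence the slope `P - σ`.
    affine-per : ∀ u → δ (q · (P ℤ.* u)) a ~ δ q a · ((P ℤ.- σ) ℤ.* u)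
    affine-per u = ~-trans (~-reflexive (δ-moved (P ℤ.* u))) (~-trans (~-· step₁ (P ℤ.* u))
        (~-trans (~-reflexive (trans (·-+ r₀ z₁ (P ℤ.* u)) (trans (cong (r₀ ·_) total-eq) (sym (·-+ r₀ z₀ ((P ℤ.- σ) ℤ.* u))))))
          (~-· (~-sym step₀) ((P ℤ.- σ) ℤ.* u))))
      where
      K = N ℕ.+ ∣ u ∣
      -- A multiple of `∣ m ∣`, so that `M` is a period of `q`, and at least `N + ∣ u ∣`, so that
      -- both `t₀` and `t₀ - u` are at least `N`.
      t₀ = ∣ m ∣ ℕ.* K
      M = + t₀ ℤ.* P
      r₀ = δ q (actE A (+ N ℤ.* P) a)
      instance ∣m∣≢0 : ℕ.NonZero ∣ m ∣
               ∣m∣≢0 = ℕ.≢-nonZero (m≢0 ∘ ℤₚ.∣i∣≡0⇒i≡0)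
      K≤t₀ : K ℕ.≤ t₀
      K≤t₀ = ℕₚ.m≤n*m K ∣ m ∣
      Per-∣m∣ : ∀ m → Per q m → Per q (+ ∣ m ∣)
      Per-∣m∣ (+ n)    p = p
      Per-∣m∣ -[1+ n ] p = Per-neg p
      Per-M : Per q M
      Per-M = subst (Per q) (trans (lem (+ K) P (+ ∣ m ∣)) (cong (ℤ._* P) (sym (ℤₚ.pos-* ∣ m ∣ K)))) (Per-* (P ℤ.* + K) (Per-∣m∣ m p))
        where lem : ∀ k p m → p ℤ.* k ℤ.* m ≡ m ℤ.* k ℤ.* p
              lem = solve-∀
      N≤ : + N ℤ.≤ + t₀ ℤ.- u
      N≤ = ℤₚ.≤-trans (ℤₚ.≤-reflexive (sym (lem (+ N) u))) (ℤₚ.+-monoˡ-≤ (ℤ.- u)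
        (ℤₚ.≤-trans (ℤₚ.+-monoʳ-≤ (+ N) (a≤∣a∣ u)) (ℤ.+≤+ K≤t₀)))
        where lem : ∀ n u → n ℤ.+ u ℤ.- u ≡ n
              lem = solve-∀
      t₁ = ∣ + t₀ ℤ.- u ∣
      t₁≡ : + t₁ ≡ + t₀ ℤ.- u
      t₁≡ = ℤₚ.0≤i⇒+∣i∣≡i (ℤₚ.≤-trans (ℤ.+≤+ ℕ.z≤n) N≤)
      z₀ z₁ : ℤ
      z₀ = (+ t₀ ℤ.- + N) ℤ.* σ ℤ.+ ℤ.- M
      z₁ = (+ t₁ ℤ.- + N) ℤ.* σ ℤ.+ ℤ.- M
      step₀ : δ q a ~ r₀ · z₀
      step₀ = ~-trans (~-reflexive (cong (δ q) (sym (L.actE-0 a)))) (~-trans (f-moved M 0ℤ Per-M)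
        (~-reflexive (trans (cong (λ z → f z · (ℤ.- M)) (ℤₚ.+-identityˡ M))
          (trans (cong (_· (ℤ.- M)) (eventually t₀ (ℕₚ.≤-trans (ℕₚ.m≤m+n N ∣ u ∣) K≤t₀))) (·-+ r₀ _ (ℤ.- M))))))
      step₁ : f (ℤ.- (P ℤ.* u)) ~ r₀ · z₁
      step₁ = ~-trans (f-moved M _ Per-M)
        (~-reflexive (trans (cong (λ z → f z · (ℤ.- M)) (trans (lem P u (+ t₀)) (cong (ℤ._* P) (sym t₁≡))))
          (trans (cong (_· (ℤ.- M)) (eventually t₁ (ℤₚ.drop‿+≤+ (subst (+ N ℤ.≤_) (sym t₁≡) N≤)))) (·-+ r₀ _ (ℤ.- M)))))
        where lem : ∀ p u t → ℤ.- (p ℤ.* u) ℤ.+ t ℤ.* p ≡ (t ℤ.- u) ℤ.* p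
              lem = solve-∀
      total-eq : z₁ ℤ.+ P ℤ.* u ≡ z₀ ℤ.+ (P ℤ.- σ) ℤ.* u
      total-eq = trans (cong (λ t → (t ℤ.- + N) ℤ.* σ ℤ.+ ℤ.- M ℤ.+ P ℤ.* u) t₁≡) (lem (+ t₀) u (+ N) σ M P)
        where lem : ∀ t u n s m p → (t ℤ.- u ℤ.- n) ℤ.* s ℤ.+ ℤ.- m ℤ.+ p ℤ.* u ≡ (t ℤ.- n) ℤ.* s ℤ.+ ℤ.- m ℤ.+ (p ℤ.- s) ℤ.* u
              lem = solve-∀

module Slopes {A : List ℕ} (D : Desc A) (isDFA : IsEquivariantDFA D) where
  open Automaton D isDFA
  open Affine D isDFA

  env2 : ℤ → ℤ → Env 2
  env2 x y Fin.zero           = x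
  env2 x y (Fin.suc Fin.zero) = y

  -- The target comes first because it is the variable to be eliminated. Canonicity ensures that an
  -- integer solution is itself the representative at which the transition formula is read.
  graphD : ∀ i j l → Dfn 3 (λ ρ → Canonical (lookup states l) (ρ Fin.zero) ×
    ⟦ Desc.trans D i j l ⟧ (env3 (ρ (Fin.suc Fin.zero)) (ρ (Fin.suc (Fin.suc Fin.zero))) (ρ Fin.zero)))
  graphD i j l = canonicalD (lookup states l) (varT Fin.zero) ×D
    substD (formulaD (Desc.trans D i j l)) {λ ρ → env3 (ρ (Fin.suc Fin.zero)) (ρ (Fin.suc (Fin.suc Fin.zero))) (ρ Fin.zero)}
      λ { Fin.zero → varT (Fin.suc Fin.zero) ; (Fin.suc Fin.zero) → varT (Fin.suc (Fin.suc Fin.zero)) ; (Fin.suc (Fin.suc Fin.zero)) → varT Fin.zero }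

  graph : Orb → L.Orb → Orb → QF 3
  graph i j l = Dfn.formula (graphD i j l)

  graph-sound : ∀ i j l x y s → Sat (graph i j l) (extend s (env2 x y)) ⟺ (Canonical (lookup states l) s × ⟦ Desc.trans D i j l ⟧ (env3 x y s))
  graph-sound i j l x y s = Dfn.correct (graphD i j l) (extend s (env2 x y))

  cands : Orb → L.Orb → Orb → List (ℕ × Term 2)
  cands i j l = candidates (graph i j l)

  cand : ∀ i j l → Fin (length (cands i j l)) → QF 2
  cand i j l c = at (graph i j l) (lookup (cands i j l) c)

  -- Letter orbits isomorphic to ℤ have characteristic 0 and ask for no divisibility; the value 1
  -- keeps the product `Pℕ` nonzero.
  nonzero : ℕ → ℕ
  nonzero zero    = 1
  nonzero (suc k) = suc k

  nonzero≢0 : ∀ k → ℕ.NonZero (nonzero k)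
  nonzero≢0 zero    = _
  nonzero≢0 (suc k) = _

  modulus : Orb → L.Orb → Orb → ℕ
  modulus i j l = ∏ λ c → period (cand i j l c)

  -- The first factor makes translation by `P` fix every letter of a finite orbit; the second is a
  -- common multiple of the periods of all candidate formulas. Both are read off the description, so
  -- `P` is uniform in state and letter.
  Pℕ : ℕ
  Pℕ = ∏ (λ j → nonzero (lookup A j)) ℕ.* ∏ λ i → ∏ λ j → ∏ λ l → modulus i j l

  Pℕ≢0 : ℕ.NonZero Pℕ
  Pℕ≢0 = ℕₚ.m*n≢0 _ _ {{∏≢0 _ λ j → nonzero≢0 (lookup A j)}}
    {{∏≢0 _ λ i → ∏≢0 _ λ j → ∏≢0 _ λ l → ∏≢0 _ λ c → period≢0 (cand i j l c)}}

  P : ℤ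
  P = + Pℕ

  letter-∣ : ∀ j → nonzero (lookup A j) ℕᵈ.∣ Pℕ
  letter-∣ j = ℕᵈ.∣-trans (∣∏ (λ j → nonzero (lookup A j)) j) (ℕᵈ.m∣m*n _)

  cand-∣ : ∀ i j l c → + period (cand i j l c) ∣ P
  cand-∣ i j l c = ∣ᵤ⇒∣ (ℕᵈ.∣-trans (∣∏ (λ c → period (cand i j l c)) c) (ℕᵈ.∣-trans (∣∏ (λ l → modulus i j l) l)
    (ℕᵈ.∣-trans (∣∏ (λ j → ∏ λ l → modulus i j l) j) (ℕᵈ.∣-trans (∣∏ (λ i → ∏ λ j → ∏ λ l → modulus i j l) i)
      (ℕᵈ.n∣m*n (∏ (λ j → nonzero (lookup A j))))))))

  drift : ℕ → ℤ
  drift zero    = P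
  drift (suc k) = 0ℤ

  drift-∣ : ∀ k → P ∣ drift k
  drift-∣ zero    = ∣-refl
  drift-∣ (suc k) = divides 0ℤ refl

  rep-drift : ∀ k → nonzero k ℕᵈ.∣ Pℕ → ∀ t x → rep k (act k (+ t ℤ.* P) x) ≡ rep k x ℤ.+ + t ℤ.* drift k
  rep-drift zero    k∣P t x = refl
  rep-drift (suc k) k∣P t x = trans (cong (rep (suc k)) x≡) (sym (trans (cong (λ z → rep (suc k) x ℤ.+ z) (ℤₚ.*-zeroʳ (+ t))) (ℤₚ.+-identityʳ _)))
    where
    lem : ∀ r z → r ℤ.+ z ℤ.- r ≡ z
    lem = solve-∀
    x≡ : act (suc k) (+ t ℤ.* P) x ≡ x
    x≡ = trans (act-rep (suc k) (+ t ℤ.* P) x) (trans (proj₂ (ι-≡ (suc k) (rep (suc k) x ℤ.+ + t ℤ.* P) (rep (suc k) x))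
      (subst (+ suc k ∣_) (sym (lem (rep (suc k) x) (+ t ℤ.* P))) (∣n⇒∣m*n (+ t) (∣ᵤ⇒∣ k∣P)))) (ι-rep (suc k) x))

  module _ (q : State D) (a : Letter D) where
    private
      i = orbit states q
      j = orbit A a
      x = repE states q
      y = repE A a

    letterAt : ℕ → Letter D
    letterAt t = actE A (+ t ℤ.* P) a

    private
      v : Env 2
      v = env2 0ℤ (drift (lookup A j))

      ρ : ℕ → Env 2
      ρ t = ray (env2 x y) v t

      P∣v : ∀ k → P ∣ v k
      P∣v Fin.zero           = divides 0ℤ refl
      P∣v (Fin.suc Fin.zero) = drift-∣ (lookup A j)

      ρ≗ : ∀ t k → env2 x (repE A (letterAt t)) k ≡ ρ t k
      ρ≗ t Fin.zero           = sym (trans (cong (λ z → x ℤ.+ z) (ℤₚ.*-zeroʳ (+ t))) (ℤₚ.+-identityʳ x))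
      ρ≗ t (Fin.suc Fin.zero) = rep-drift (lookup A j) (letter-∣ j) t (proj₂ a)

      evc : ∀ l c → EventuallyConstant (λ t → Sat (cand i j l c) (ρ t))
      evc l c = eventually-constant (cand i j l c) (env2 x y) v (λ k → ∣-trans (cand-∣ i j l c) (P∣v k))

    threshold : ℕ
    threshold = maximum λ l → maximum λ c → proj₁ (evc l c)

    private
      cand-stable : ∀ l c → StableFrom threshold (λ t → Sat (cand i j l c) (ρ t))
      cand-stable l c = stable {λ t → Sat (cand i j l c) (ρ t)} (evc l c)
        (ℕₚ.≤-trans (≤-maximum (λ c → proj₁ (evc l c)) c) (≤-maximum (λ l → maximum λ c → proj₁ (evc l c)) l))

      l = orbit states (δ q (letterAt threshold))
      s = repE states (δ q (letterAt threshold))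

      Γ = graph i j l

      extend-cong : ∀ {n} s {ρ ρ′ : Env n} → (∀ k → ρ k ≡ ρ′ k) → ∀ k → extend s ρ k ≡ extend s ρ′ k
      extend-cong s e Fin.zero    = refl
      extend-cong s e (Fin.suc k) = e k

      Γ⇔ : ∀ s t → Sat Γ (extend s (ρ t)) ⟺ (Canonical (lookup states l) s × ⟦ Desc.trans D i j l ⟧ (env3 x (repE A (letterAt t)) s))
      Γ⇔ s t = ⟺-trans (respects Γd (extend-cong s (sym ∘ ρ≗ t)) , respects Γd (extend-cong s (ρ≗ t))) (graph-sound i j l x (repE A (letterAt t)) s)
        where Γd : Dfn 3 (Sat Γ)
              Γd = dfn Γ (λ _ → ⟺-refl)

      start : Candidate Γ (ρ threshold)
      start = candidate Γ (ρ threshold) s (proj₂ (Γ⇔ s threshold) (canonical-rep _ _ , δ-Δ q (letterAt threshold)))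

      c∈ = proj₂ (proj₂ start)
      c = Any.index c∈
      k = proj₁ (lookup (cands i j l) c)
      T = proj₂ (lookup (cands i j l) c)

      reach : ∀ t → threshold ℕ.≤ t → Σ ℤ λ s → Solves (ρ t) s (k , T) × Sat Γ (extend s (ρ t))
      reach t t≥ = Sat-at⁻ Γ (ρ t) (lookup (cands i j l) c)
        (cand-stable l c (Sat-at⁺ Γ (ρ threshold) {x = proj₁ start} {c = lookup (cands i j l) c} (Anyₚ.lookup-index c∈) (proj₁ (proj₂ start))) t t≥)

      target : ∀ t → threshold ℕ.≤ t → ℤ
      target t t≥ = proj₁ (reach t t≥)

      -- Elimination may produce another integer than the one the search started from; since `δ` is
      -- functional, every canonical solution names the target state.
      δ-target : ∀ t t≥ → δ q (letterAt t) ≡ pt l (target t t≥)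
      δ-target t t≥ = δ-unique (subst (λ s → ⟦ Desc.trans D i j l ⟧ (env3 x (repE A (letterAt t)) s))
          (canonical-unique (lookup states l) (target t t≥) (target t t≥) can
             (subst (+ lookup states l ∣_) (sym (ℤₚ.+-inverseʳ (target t t≥))) (divides 0ℤ refl)))
          tr)
        where
        can = proj₁ (proj₁ (Γ⇔ (target t t≥) t) (proj₂ (proj₂ (reach t t≥))))
        tr = proj₂ (proj₁ (Γ⇔ (target t t≥) t) (proj₂ (proj₂ (reach t t≥))))

      σ = slopeTerm T v

      target-eq : ∀ t t≥ → + suc k ℤ.* target t t≥ ≡ ⟦ T ⟧t (env2 x y) ℤ.+ + t ℤ.* σ
      target-eq t t≥ = trans (proj₁ (proj₂ (reach t t≥))) (term-ray T (env2 x y) v t)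

    -- Along multiples of P the target is eventually given by one candidate, hence affine.
    slopeℤ : ℤ
    slopeℤ = target (suc threshold) (ℕₚ.n≤1+n _) ℤ.- target threshold ℕₚ.≤-refl

    private
      target-affine : ∀ t t≥ → target t t≥ ≡ target threshold ℕₚ.≤-refl ℤ.+ (+ t ℤ.- + threshold) ℤ.* slopeℤ
      target-affine = affine k threshold (⟦ T ⟧t (env2 x y)) σ target target-eq

    eventually-affine : ∀ t → threshold ℕ.≤ t → δ q (letterAt t) ≡ δ q (letterAt threshold) · ((+ t ℤ.- + threshold) ℤ.* slopeℤ)
    eventually-affine t t≥ = trans (δ-target t t≥) (trans (cong (pt l) (target-affine t t≥))
      (trans (sym (actE-pt d l s₀)) (cong (_· d) (sym (δ-target threshold ℕₚ.≤-refl)))))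
      where d = (+ t ℤ.- + threshold) ℤ.* slopeℤ
            s₀ = target threshold ℕₚ.≤-refl

  tail : ∀ q m → m ≢ 0ℤ → Per q m → ∀ a → Σ ℤ λ c → ∀ u → δ (q · (P ℤ.* u)) a ~ δ q a · (c ℤ.* u)
  tail q m m≢0 p a = P ℤ.- slopeℤ q a , affine-per P q a (threshold q a) (slopeℤ q a) (eventually-affine q a) m m≢0 p

-- Deciding the Nerode equivalence

-- Parameters are eliminated one at a time. Even environments without variables need not be equal as
-- functions, hence the appeals to `respects`.
decExistsEnv : ∀ N {P} → Dfn N P → Dec (Σ (Env N) P)
decExistsEnv zero {P}  d = map′ (λ p → ε , p) (λ (ρ , p) → respects d {ρ} {ε} (λ ()) p) (decD d ε)
  where ε : Env 0
        ε ()
decExistsEnv (suc N) {P} d = map′ (λ (ρ , x , p) → extend x ρ , p)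
  (λ (ρ , p) → ρ ∘ Fin.suc , ρ Fin.zero , respects d {ρ} (λ { Fin.zero → refl ; (Fin.suc i) → refl }) p)
  (decExistsEnv N (∃E d))

-- Double negation commutes with finite conjunctions, so classical case distinctions can be made for
-- all orbits at once.
¬¬-∀Fin : ∀ {m} {P : Fin m → Set} → (∀ i → ¬ ¬ P i) → ¬ ¬ (∀ i → P i)
¬¬-∀Fin {zero}  f k = k λ ()
¬¬-∀Fin {suc m} f k = f Fin.zero λ p → ¬¬-∀Fin (f ∘ Fin.suc) λ g → k λ { Fin.zero → p ; (Fin.suc i) → g i }

Least : (ℕ → Set) → Set
Least P = Σ ℕ λ n → P n × (∀ {k} → k ℕ.< n → ¬ P k)

¬¬-least : ∀ {P : ℕ → Set} n → P n → ¬ ¬ Least P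
¬¬-least {P} = <-rec (λ n → P n → ¬ ¬ Least P) λ n rec p notLeast →
  notLeast (n , p , λ k<n pk → rec k<n pk notLeast)

least : ∀ {P : ℕ → Set} → (∀ n → Dec (P n)) → ∀ n → P n → Least P
least {P} P? = <-rec (λ n → P n → Least P) search
  where
  search : ∀ n → (∀ {k} → k ℕ.< n → P k → Least P) → P n → Least P
  search n rec p with ℕₚ.anyUpTo? P? n
  ... | yes (k , k<n , pk) = rec k<n pk
  ... | no none = n , p , λ k<n pk → none (_ , k<n , pk)

-- Definability of transitions and of the automaton axioms

module Definability {A : List ℕ} (D : Desc A) where
  open Desc D hiding (trans)
  open Points states
  module LP = Points A

  ΔD : ∀ {n f g h} i j l → TDfn n f → TDfn n g → TDfn n h → Dfn n (λ ρ → Δ D (pt i (f ρ)) (LP.pt j (g ρ)) (pt l (h ρ)))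
  ΔD {f = f} {g} {h} i j l s t u =
    repD (lookup states i) s {λ x ρ → ⟦ φ ⟧ (env3 x (repE A (LP.pt j (g ρ))) (repE states (pt l (h ρ))))}
    (repD (lookup A j) (wkT t) {λ y ρ → ⟦ φ ⟧ (env3 (ρ Fin.zero) y (repE states (pt l (h (ρ ∘ Fin.suc)))))}
    (repD (lookup states l) (wkT (wkT u)) {λ z ρ → ⟦ φ ⟧ (env3 (ρ (Fin.suc Fin.zero)) (ρ Fin.zero) z)}
    (substD (formulaD φ) {λ ρ → env3 (ρ (Fin.suc (Fin.suc Fin.zero))) (ρ (Fin.suc Fin.zero)) (ρ Fin.zero)}
      λ { Fin.zero → varT _ ; (Fin.suc Fin.zero) → varT _ ; (Fin.suc (Fin.suc Fin.zero)) → varT _ })))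
    where φ = Desc.trans D i j l

  Δ-cong : ∀ {q q′ a a′ r r′} → q ≡ q′ → a ≡ a′ → r ≡ r′ → Δ D q a r ⟺ Δ D q′ a′ r′
  Δ-cong refl refl refl = ⟺-refl

  private
    v0 : ∀ {n} → TDfn (suc n) (λ ρ → ρ Fin.zero)
    v0 = varT Fin.zero
    v1 : ∀ {n} → TDfn (suc (suc n)) (λ ρ → ρ (Fin.suc Fin.zero))
    v1 = varT (Fin.suc Fin.zero)
    v2 : ∀ {n} → TDfn (suc (suc (suc n))) (λ ρ → ρ (Fin.suc (Fin.suc Fin.zero)))
    v2 = varT (Fin.suc (Fin.suc Fin.zero))
    v3 : ∀ {n} → TDfn (suc (suc (suc (suc n)))) (λ ρ → ρ (Fin.suc (Fin.suc (Fin.suc Fin.zero))))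
    v3 = varT (Fin.suc (Fin.suc (Fin.suc Fin.zero)))

  -- The minimiser is a total function on descriptions, while the construction relies on the axioms;
  -- being first-order, they can be tested beforehand.
  isDFA? : Dec (IsEquivariantDFA D)
  isDFA? = map′ (λ (t , f , e , i) → record { total = t ; functional = f ; δ-equiv = e ; init-equiv = i })
                (λ d → IsEquivariantDFA.total d , IsEquivariantDFA.functional d , IsEquivariantDFA.δ-equiv d , IsEquivariantDFA.init-equiv d)
                (decD totalD ε ×-dec decD functionalD ε ×-dec decD equivD ε ×-dec decD initD ε)
    where
    ε : Env 0
    ε ()
    totalD : Dfn 0 (λ ρ → ∀ q a → Σ (State D) λ q′ → Δ D q a q′)
    totalD = ∀EltD states λ i → ∀EltD A λ j → ∃EltD states λ l → ΔD i j l v2 v1 v0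
    functionalD : Dfn 0 (λ ρ → ∀ q a q′ q″ → Δ D q a q′ → Δ D q a q″ → q′ ≡ q″)
    functionalD = ∀EltD states λ i → ∀EltD A λ j → ∀EltD states λ l → ∀EltD states λ l′ →
      ΔD i j l v3 v2 v1 →D ΔD i j l′ v3 v2 v0 →D pt-≡D states l l′ v1 v0
    equivD : Dfn 0 (λ ρ → ∀ (z : ℤ) q a q′ → Δ D q a q′ → Δ D (actE states z q) (actE A z a) (actE states z q′))
    equivD = ∀D (∀EltD states λ i → ∀EltD A λ j → ∀EltD states λ l → ΔD i j l v2 v1 v0 →D
      mapD (λ ρ → Δ-cong (sym (actE-pt _ i _)) (sym (LP.actE-pt _ j _)) (sym (actE-pt _ l _)))
           (ΔD i j l (v2 +T v3) (v1 +T v3) (v0 +T v3)))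
    initD : Dfn 0 (λ ρ → ∀ (z : ℤ) → actE states z init ≡ init)
    initD = ∀D (mapD (λ ρ → ≡⇒⟺ (cong₂ _≡_ (sym (actE-rep (ρ Fin.zero) init)) (pt-rep init)))
                     (pt-≡D states (orbit states init) (orbit states init) (conT (repE states init) +T v0) (conT (repE states init))))

-- Groups of periods and merging of orbits

module Periods {A : List ℕ} (D : Desc A) (isDFA : IsEquivariantDFA D) where
  open Automaton D isDFA

  Generator : Orb → Set
  Generator i = Σ ℕ λ m → ∀ z → Per (pt i 0ℤ) z ⟺ (+ m ∣ z)

  PosPer : Orb → ℕ → Set
  PosPer i k = Per (pt i 0ℤ) (+ suc k)

  no-generator : ∀ i → ¬ (Σ ℕ λ k → PosPer i k) → Generator i
  no-generator i none = 0 , λ z → (λ p → divides 0ℤ (zero-only z p)) , λ d → subst (Per _) (sym (0∣⇒≡0 d)) Per-0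
    where
    zero-only : ∀ z → Per (pt i 0ℤ) z → z ≡ 0ℤ
    zero-only (+ zero)  p = refl
    zero-only (+ suc k) p = contradiction (k , p) none
    zero-only -[1+ k ]  p = contradiction (k , Per-neg p) none

  least-generator : ∀ i → Least (PosPer i) → Generator i
  least-generator i (k , p , min) = suc k , λ z → (λ pz → go z (z %ℕ suc k) refl pz) , λ { (divides c refl) → Per-* c p }
    where
    lem : ∀ r y → r ℤ.+ y ℤ.- y ≡ r
    lem = solve-∀
    go : ∀ z r → z %ℕ suc k ≡ r → Per (pt i 0ℤ) z → + suc k ∣ z
    go z zero eq pz = divides (z /ℕ suc k) (trans (a≡a%ℕn+[a/ℕn]*n z (suc k))
      (trans (cong (λ r → + r ℤ.+ (z /ℕ suc k) ℤ.* + suc k) eq) (ℤₚ.+-identityˡ _)))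
    go z (suc r) eq pz = ⊥-elim (min (ℕₚ.≤-pred (subst (ℕ._< suc k) eq (n%ℕd<d z (suc k))))
      (subst (λ r → Per (pt i 0ℤ) (+ r)) eq
        (subst (Per (pt i 0ℤ)) (trans (cong (ℤ._- y) (a≡a%ℕn+[a/ℕn]*n z (suc k))) (lem (+ (z %ℕ suc k)) y))
          (Per-+ pz (Per-neg (Per-* (z /ℕ suc k) p))))))
      where y = (z /ℕ suc k) ℤ.* + suc k

  -- No procedure yet decides whether a positive period exists, so the case distinction is made
  -- under double negation.
  ¬¬-generator : ∀ i → ¬ ¬ Generator i
  ¬¬-generator i k = ¬¬-excluded-middle {A = Σ ℕ (PosPer i)} λ
    { (yes (m , p)) → ¬¬-least m p (k ∘ least-generator i)
    ; (no none)     → k (no-generator i none) }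

  pt-0 : ∀ q → pt (orbit states q) 0ℤ · repE states q ≡ q
  pt-0 q = trans (actE-pt (repE states q) _ 0ℤ) (trans (cong (pt _) (ℤₚ.+-identityˡ _)) (pt-rep q))

  pt-· : ∀ i x → pt i x ≡ pt i 0ℤ · x
  pt-· i x = sym (trans (actE-pt x i 0ℤ) (cong (pt i) (ℤₚ.+-identityˡ x)))

  Per-orbit : ∀ q z → Per q z ⟺ Per (pt (orbit states q) 0ℤ) z
  Per-orbit q z =
    (λ p → subst (λ r → Per r z) (trans (cong (_· (ℤ.- repE states q)) (sym (pt-0 q)))
       (trans (·-+ _ (repE states q) (ℤ.- repE states q)) (trans (cong (pt _ 0ℤ ·_) (ℤₚ.+-inverseʳ (repE states q))) (actE-0 _)))) (Per-shift (ℤ.- repE states q) p)) ,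
    (λ p → subst (λ r → Per r z) (pt-0 q) (Per-shift (repE states q) p))

  -- By equivariance one such displacement makes every point of `i` equivalent to a point of `l`:
  -- the two orbits have the same image in the minimal automaton.
  Merge : Orb → Orb → Set
  Merge i l = Σ ℤ λ z → pt i 0ℤ ~ pt l z

  ~-at-0 : ∀ {q r} → q ~ r → pt (orbit states q) 0ℤ ~ pt (orbit states r) (repE states r ℤ.- repE states q)
  ~-at-0 {q} {r} e = ~-trans (~-reflexive (trans (sym (actE-0 _)) (trans (cong (pt _ 0ℤ ·_) (sym (ℤₚ.+-inverseʳ (repE states q))))
      (trans (sym (·-+ _ (repE states q) (ℤ.- repE states q))) (cong (_· (ℤ.- repE states q)) (pt-0 q))))))
    (~-trans (~-· e (ℤ.- repE states q)) (~-reflexive (actE-rep _ r)))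

  at-0-~ : ∀ {q r} → pt (orbit states q) 0ℤ ~ pt (orbit states r) (repE states r ℤ.- repE states q) → q ~ r
  at-0-~ {q} {r} e = ~-trans (~-reflexive (sym (pt-0 q))) (~-trans (~-· e (repE states q))
    (~-reflexive (trans (actE-pt _ _ _) (trans (cong (pt _) (lem (repE states r) (repE states q))) (pt-rep r)))))
    where lem : ∀ a b → a ℤ.- b ℤ.+ b ≡ a
          lem = solve-∀

  pt~⇒Per : ∀ {l y z} → pt l y ~ pt l z → Per (pt l 0ℤ) (y ℤ.- z)
  pt~⇒Per {l} {y} {z} e = ~⇒Per (subst₂ _~_ (pt-· l y) (pt-· l z) e)

  Per⇒pt~ : ∀ {l y z} → Per (pt l 0ℤ) (y ℤ.- z) → pt l y ~ pt l z
  Per⇒pt~ {l} {y} {z} p = subst₂ _~_ (sym (pt-· l y)) (sym (pt-· l z)) (Per⇒~ p)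

module PeriodBound {A : List ℕ} (D : Desc A) (isDFA : IsEquivariantDFA D) where
  open Automaton D isDFA
  open Periods D isDFA
  open Slopes D isDFA using (P; Pℕ; Pℕ≢0; tail)

  -- Computed from the description alone and proved to bound whichever generators exist, so the
  -- decision procedure does not presuppose what it decides.
  C : ℕ
  C = ∣ P ℤ.^ suc (length states) ∣

  module _ (gen : ∀ i → Generator i) where
    period≤C : ∀ i → proj₁ (gen i) ℕ.< suc C
    period≤C i with proj₁ (gen i) ℕ.≟ 0
    ... | yes m≡0 = subst (ℕ._< suc C) (sym m≡0) (ℕ.s≤s ℕ.z≤n)
    ... | no m≢0  = ℕ.s≤s (ℕᵈ.∣⇒≤ {{ℕ.≢-nonZero C≢0}} (∣⇒∣ᵤ (Bounded.period-bound P tail (proj₁ ∘ gen)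
                      (λ q z → ⟺-trans (Per-orbit q z) (proj₂ (gen (orbit states q)) z)) i m≢0)))
      where
      C≢0 : C ≢ 0
      C≢0 eq = ℕ.≢-nonZero⁻¹ Pℕ {{Pℕ≢0}} (ℤₚ.+-injective (ℤₚ.i^n≡0⇒i≡0 P (suc (length states)) (ℤₚ.∣i∣≡0⇒i≡0 eq)))

module Equivalence {A : List ℕ} (D : Desc A) (isDFA : IsEquivariantDFA D) (C : ℕ)
  (period≤C : (gen : ∀ i → Periods.Generator D isDFA i) → ∀ i → proj₁ (gen i) ℕ.< suc C) where
  open Automaton D isDFA
  open Periods D isDFA
  open Definability D

  private
    n = length states
    N = n ℕ.* n ℕ.+ n ℕ.* n

  -- A parameter vector ρ encodes, for orbits i and l, an offset and a modulus
  -- (negative when no element of i is related to an element of l).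
  offset modulus : Orb → Orb → Fin N
  offset  i l = combine i l ↑ˡ (n ℕ.* n)
  modulus i l = (n ℕ.* n) ↑ʳ combine i l

  -- Divisibility by a variable modulus is not Presburger; letting `c` range over the values up to
  -- `C` turns it into a finite disjunction. This is the purpose of the bound.
  Related′ : Env N → Orb → Orb → ℤ → ℤ → Set
  Related′ ρ i l x y = Σ (Fin (suc C)) λ c → (ρ (modulus i l) ≡ + toℕ c) × (+ toℕ c ∣ y ℤ.- x ℤ.- ρ (offset i l))

  Related : Env N → State D → State D → Set
  Related ρ q r = Related′ ρ (orbit states q) (orbit states r) (repE states q) (repE states r)

  record Bisimulation (ρ : Env N) : Set where
    constructor bisim
    field
      same-acc : ∀ q q′ → Related ρ q q′ → acc q ≡ acc q′
      advance  : ∀ q q′ a r r′ → Related ρ q q′ → Δ D q a r → Δ D q′ a r′ → Related ρ r r′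
  open Bisimulation

  bisimulation-sound : ∀ {ρ q r} → Bisimulation ρ → Related ρ q r → q ~ r
  bisimulation-sound {ρ} b rel = mk~ λ w → go w rel
    where
    go : ∀ w {q r} → Related ρ q r → accepts q w ≡ accepts r w
    go []      rel = same-acc b _ _ rel
    go (a ∷ w) rel = go w (advance b _ _ a _ _ rel (δ-Δ _ a) (δ-Δ _ a))

  RelatedD : ∀ {M f g} i l (e : Env M → Env N) → (∀ k → TDfn M (λ ρ → e ρ k)) → TDfn M f → TDfn M g →
    Dfn M (λ ρ → Related (e ρ) (pt i (f ρ)) (pt l (g ρ)))
  RelatedD {g = g} i l e te s t =
    repD (lookup states i) s {λ x ρ → Related′ (e ρ) i l x (repE states (pt l (g ρ)))}
    (repD (lookup states l) (wkT t) {λ y ρ → Related′ (e (ρ ∘ Fin.suc)) i l (ρ Fin.zero) y}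
    (∃FinD λ c → (wkT (wkT (te (modulus i l))) ≡D conT (+ toℕ c)) ×D
      divD (toℕ c) (varT Fin.zero -T varT (Fin.suc Fin.zero) -T wkT (wkT (te (offset i l))))))

  BisimulationD : Dfn N Bisimulation
  BisimulationD = mapD (λ ρ → (λ (s , a) → bisim s a) , λ b → same-acc b , advance b) (accD ×D advD)
    where
    accD : Dfn N (λ ρ → ∀ q q′ → Related ρ q q′ → acc q ≡ acc q′)
    accD = ∀EltD states λ i → ∀EltD states λ l →
      RelatedD i l (λ ρ → ρ ∘ Fin.suc ∘ Fin.suc) (λ k → varT _) (varT (Fin.suc Fin.zero)) (varT Fin.zero)
        →D constD (acc (pt i 0ℤ) Boolₚ.≟ acc (pt l 0ℤ))
    advD : Dfn N (λ ρ → ∀ q q′ a r r′ → Related ρ q q′ → Δ D q a r → Δ D q′ a r′ → Related ρ r r′)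
    advD = ∀EltD states λ i → ∀EltD states λ l → ∀EltD A λ j → ∀EltD states λ i′ → ∀EltD states λ l′ →
      RelatedD i l e te x4 x3 →D ΔD i j i′ x4 x2 x1 →D ΔD l j l′ x3 x2 x0 →D RelatedD i′ l′ e te x1 x0
      where
      e : Env (5 ℕ.+ N) → Env N
      e ρ = ρ ∘ Fin.suc ∘ Fin.suc ∘ Fin.suc ∘ Fin.suc ∘ Fin.suc
      te : ∀ k → TDfn (5 ℕ.+ N) (λ ρ → e ρ k)
      te k = varT _
      x0 = varT {5 ℕ.+ N} Fin.zero
      x1 = varT {5 ℕ.+ N} (Fin.suc Fin.zero)
      x2 = varT {5 ℕ.+ N} (Fin.suc (Fin.suc Fin.zero))
      x3 = varT {5 ℕ.+ N} (Fin.suc (Fin.suc (Fin.suc Fin.zero)))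
      x4 = varT {5 ℕ.+ N} (Fin.suc (Fin.suc (Fin.suc (Fin.suc Fin.zero))))

  module Complete (gen : ∀ i → Generator i) (merge? : ∀ i l → Dec (Merge i l)) where
    offsetOf : ∀ {i l} → Dec (Merge i l) → ℤ
    offsetOf (yes (z , _)) = z
    offsetOf (no _)        = 0ℤ

    modulusOf : ∀ {i l} → Dec (Merge i l) → ℤ
    modulusOf {l = l} (yes _) = + proj₁ (gen l)
    modulusOf         (no _)  = -[1+ 0 ]

    offsets moduli : Orb × Orb → ℤ
    offsets (i , l) = offsetOf (merge? i l)
    moduli  (i , l) = modulusOf (merge? i l)

    select : Fin (n ℕ.* n) ⊎ Fin (n ℕ.* n) → ℤ
    select = [ offsets ∘ remQuot n , moduli ∘ remQuot n ]′

    params : Env N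
    params k = select (splitAt (n ℕ.* n) k)

    params-offset : ∀ i l → params (offset i l) ≡ offsetOf (merge? i l)
    params-offset i l = trans (cong select (Finₚ.splitAt-↑ˡ (n ℕ.* n) (combine i l) (n ℕ.* n))) (cong offsets (Finₚ.remQuot-combine i l))

    params-modulus : ∀ i l → params (modulus i l) ≡ modulusOf (merge? i l)
    params-modulus i l = trans (cong select (Finₚ.splitAt-↑ʳ (n ℕ.* n) (n ℕ.* n) (combine i l))) (cong moduli (Finₚ.remQuot-combine i l))

    complete : ∀ {q r} → q ~ r → Related params q r
    complete {q} {r} e with merge? i l | params-offset i l | params-modulus i l
      where i = orbit states q
            l = orbit states r
    ... | no ¬m | _ | _ = contradiction (_ , ~-at-0 e) ¬m
    ... | yes (z , ez) | off | mod = fromℕ< (period≤C gen (orbit states r)) ,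
      trans mod (cong +_ (sym (Finₚ.toℕ-fromℕ< _))) ,
      subst₂ (λ c o → + c ∣ repE states r ℤ.- repE states q ℤ.- o) (sym (Finₚ.toℕ-fromℕ< _)) (sym off)
        (proj₁ (proj₂ (gen (orbit states r)) _) (pt~⇒Per (~-trans (~-sym (~-at-0 e)) ez)))

    sound : ∀ {q r} → Related params q r → q ~ r
    sound {q} {r} (c , mod≡ , d) with merge? i l | params-offset i l | params-modulus i l
      where i = orbit states q
            l = orbit states r
    ... | no ¬m | _ | mod = contradiction (trans (sym mod) mod≡) λ ()
    ... | yes (z , ez) | off | mod = at-0-~ (~-trans ez (~-sym (Per⇒pt~ (proj₂ (proj₂ (gen (orbit states r)) _)
      (subst₂ (λ c o → c ∣ repE states r ℤ.- repE states q ℤ.- o) (trans (sym mod≡) mod) off d)))))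

    bisimulation : Bisimulation params
    bisimulation = bisim (λ q r rel → on (sound rel) [])
      λ q q′ a r r′ rel t t′ → complete (subst₂ _~_ (δ-unique t) (δ-unique t′) (~-δ (sound rel) a))

  -- `Complete.params` encodes `~` itself but takes generators and merge decisions as input;
  -- finitely many double-negated choices supply them.
  ¬¬-complete : ¬ ¬ (Σ (Env N) λ ρ → Bisimulation ρ × (∀ {q r} → q ~ r → Related ρ q r))
  ¬¬-complete k = ¬¬-∀Fin ¬¬-generator λ gen → ¬¬-∀Fin (λ i → ¬¬-∀Fin λ l → ¬¬-excluded-middle {A = Merge i l}) λ merge? →
    k (Complete.params gen merge? , Complete.bisimulation gen merge? , Complete.complete gen merge?)

  MergeVia : (ℤ → Set) → Orb → Orb → Env N → Set
  MergeVia R i l ρ = Bisimulation ρ × Σ ℤ λ z → R z × Related ρ (pt i 0ℤ) (pt l z)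

  MergeViaD : ∀ {R : ℤ → Set} → Dfn 1 (λ ρ → R (ρ Fin.zero)) → ∀ i l → Dfn N (MergeVia R i l)
  MergeViaD {R} r i l = BisimulationD ×D ∃D {P = λ z ρ → R z × Related ρ (pt i 0ℤ) (pt l z)}
    (substD r {λ ρ _ → ρ Fin.zero} (λ _ → varT Fin.zero) ×D
     RelatedD i l (λ ρ → ρ ∘ Fin.suc) (λ k → varT _) (conT 0ℤ) (varT Fin.zero))

  -- `R` is a definable condition on the displacement, so one procedure decides merging, a given
  -- period and the existence of a period. A positive answer carries a bisimulation; a negative one
  -- excludes the equivalence by `¬¬-complete`.
  decMerge : ∀ {R : ℤ → Set} → Dfn 1 (λ ρ → R (ρ Fin.zero)) → ∀ i l → Dec (Σ ℤ λ z → R z × pt i 0ℤ ~ pt l z)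
  decMerge {R} r i l = map′ (λ (ρ , b , z , Rz , rel) → z , Rz , bisimulation-sound b rel)
    (λ (z , Rz , e) → decidable-stable via? λ none → ¬¬-complete λ (ρ , b , c) → none (ρ , b , z , Rz , c e)) via?
    where
    via? : Dec (Σ (Env N) (MergeVia R i l))
    via? = decExistsEnv N (MergeViaD r i l)

  merge? : ∀ i l → Dec (Merge i l)
  merge? i l = map′ (λ (z , _ , e) → z , e) (λ (z , e) → z , tt , e) (decMerge {λ _ → ⊤} (constD (yes tt)) i l)

  posPer? : ∀ i k → Dec (PosPer i k)
  posPer? i k = map′ (λ { (_ , refl , e) → ~-trans (~-reflexive (sym (pt-· i _))) (~-sym e) })
                     (λ p → _ , refl , ~-sym (~-trans (~-reflexive (pt-· i _)) p))
                     (decMerge {_≡ + suc k} (varT Fin.zero ≡D conT (+ suc k)) i i)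

  somePer? : ∀ i → Dec (Σ ℕ (PosPer i))
  somePer? i = map′ (λ { (+ suc k , _ , e) → k , ~-trans (~-reflexive (sym (pt-· i _))) (~-sym e) ; (+ 0 , ℤ.+≤+ () , _) })
                    (λ (k , p) → + suc k , ℤ.+≤+ (ℕ.s≤s ℕ.z≤n) , ~-sym (~-trans (~-reflexive (pt-· i _)) p))
                    (decMerge {+ 1 ℤ.≤_} (conT (+ 1) ≤D varT Fin.zero) i i)

  -- One quantified query tells whether a positive period exists; its witness then bounds the search
  -- for the least one.
  generator : ∀ i → Generator i
  generator i = find (somePer? i)
    where
    find : Dec (Σ ℕ (PosPer i)) → Generator i
    find (yes (k , p)) = least-generator i (least (posPer? i) k p)
    find (no none)     = no-generator i none

-- The quotient automaton

true-⟺⇒≡ : ∀ {a b : Bool} → (a ≡ true) ⟺ (b ≡ true) → a ≡ b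
true-⟺⇒≡ {false} {false} _       = refl
true-⟺⇒≡ {false} {true}  (_ , g) = g refl
true-⟺⇒≡ {true}  {b}     (f , _) = sym (f refl)

≡⇒true-⟺ : ∀ {a b : Bool} → a ≡ b → (a ≡ true) ⟺ (b ≡ true)
≡⇒true-⟺ refl = ⟺-refl

module Quotient {A : List ℕ} (D : Desc A) (isDFA : IsEquivariantDFA D)
  (generator : ∀ i → Periods.Generator D isDFA i)
  (merge? : ∀ i l → Dec (Periods.Merge D isDFA i l)) where
  open Automaton D isDFA
  open Periods D isDFA
  open Definability D

  μ : Orb → ℕ
  μ i = proj₁ (generator i)

  Merge-refl : ∀ i → Merge i i
  Merge-refl i = 0ℤ , ~-refl

  Merge-sym : ∀ {i l} → Merge i l → Merge l i
  Merge-sym {i} {l} (z , e) = ℤ.- z , ~-trans (~-reflexive (sym (trans (actE-pt (ℤ.- z) l z) (cong (pt l) (ℤₚ.+-inverseʳ z)))))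
    (~-trans (~-· (~-sym e) (ℤ.- z)) (~-reflexive (sym (pt-· i (ℤ.- z)))))

  ~-pt : ∀ {i l z} → pt i 0ℤ ~ pt l z → ∀ x → pt i x ~ pt l (z ℤ.+ x)
  ~-pt {i} {l} {z} e x = ~-trans (~-reflexive (pt-· i x)) (~-trans (~-· e x) (~-reflexive (actE-pt x l z)))

  -- Representatives of pairwise unmerged reachable orbits, listed by the characteristics of their quotients.
  record Representatives : Set where
    field
      chars  : List ℕ
      orb    : Fin (length chars) → Orb
      char   : ∀ i → lookup chars i ≡ μ (orb i)
      reach  : ∀ i → Σ (Word D) λ u → orbit states (run init u) ≡ orb i
      apart  : ∀ i j → Merge (orb i) (orb j) → i ≡ j
      source : Σ (Fin (length chars)) λ i → Merge (orbit states init) (orb i)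

    Covered : Orb → Set
    Covered o = Σ (Fin (length chars)) λ l → Merge o (orb l)

    covered? : ∀ o → Dec (Covered o)
    covered? o = Finₚ.any? (λ l → merge? o (orb l))

    Edge : Fin (length chars) → L.Orb → Orb → Set
    Edge i j o = Σ ℤ λ x → Σ ℤ λ y → Σ ℤ λ s → Δ D (pt (orb i) x) (L.pt j y) (pt o s)

    edge? : ∀ i j o → Dec (Edge i j o)
    edge? i j o = decD edgeD λ ()
      where
      edgeD : Dfn 0 (λ _ → Edge i j o)
      edgeD = ∃D (∃D (∃D (ΔD (orb i) j o (varT (Fin.suc (Fin.suc Fin.zero))) (varT (Fin.suc Fin.zero)) (varT Fin.zero))))

    Missing : Set
    Missing = Σ (Fin (length chars)) λ i → Σ L.Orb λ j → Σ Orb λ o → Edge i j o × ¬ Covered o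

    missing? : Dec Missing
    missing? = Finₚ.any? λ i → Finₚ.any? λ j → Finₚ.any? λ o → edge? i j o ×-dec ¬? (covered? o)

    Closed : Set
    Closed = ∀ i a q → orbit states q ≡ orb i → Covered (orbit states (δ q a))

    closed : ¬ Missing → Closed
    closed none i a q refl = decidable-stable (covered? _) λ ¬c → none (i , orbit A a , orbit states (δ q a) ,
      (repE states q , repE A a , repE states (δ q a) ,
        proj₁ (Δ-cong (sym (pt-rep q)) (sym (L.pt-rep a)) (sym (pt-rep (δ q a)))) (δ-Δ q a)) , ¬c)
  open Representatives

  -- The edge may start at another point of the orbit than the one that `u` reaches; equivariance
  -- lets it be translated by the difference `d`.
  reach-edge : ∀ V i j o → Edge V i j o → Σ (Word D) λ u → orbit states (run init u) ≡ o
  reach-edge V i j o (x , y , s , t) with reach V i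
  ... | u , u≡ = u ++ a ∷ [] , cong (orbit states) (trans (run-++ init u (a ∷ [])) (trans (cong (λ q → δ q a) q≡) moved))
    where
    q = run init u
    d = repE states q ℤ.- x
    a = actE A d (L.pt j y)
    lem : ∀ r x → x ℤ.+ (r ℤ.- x) ≡ r
    lem = solve-∀
    q≡ : q ≡ pt (orb V i) x · d
    q≡ = trans (sym (pt-rep q)) (trans (cong₂ pt u≡ (sym (lem (repE states q) x))) (sym (actE-pt d _ x)))
    moved : δ (pt (orb V i) x · d) a ≡ pt o s · d
    moved = trans (δ-· _ _ d) (cong (_· d) (δ-unique t))

  extendReps : (V : Representatives) → ∀ o → (Σ (Word D) λ u → orbit states (run init u) ≡ o) → ¬ Covered V o → Representatives
  extendReps V o r ¬c = record
    { chars  = μ o ∷ chars V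
    ; orb    = orb′
    ; char   = λ { Fin.zero → refl ; (Fin.suc i) → char V i }
    ; reach  = λ { Fin.zero → r ; (Fin.suc i) → reach V i }
    ; apart  = apart′
    ; source = Fin.suc (proj₁ (source V)) , proj₂ (source V)
    }
    where
    orb′ : Fin (suc (length (chars V))) → Orb
    orb′ Fin.zero    = o
    orb′ (Fin.suc i) = orb V i
    apart′ : ∀ i j → Merge (orb′ i) (orb′ j) → i ≡ j
    apart′ Fin.zero    Fin.zero    m = refl
    apart′ Fin.zero    (Fin.suc j) m = contradiction (j , m) ¬c
    apart′ (Fin.suc i) Fin.zero    m = contradiction (i , Merge-sym m) ¬c
    apart′ (Fin.suc i) (Fin.suc j) m = cong Fin.suc (apart V i j m)

  initialReps : Representatives
  initialReps = record
    { chars  = μ (orbit states init) ∷ []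
    ; orb    = λ _ → orbit states init
    ; char   = λ { Fin.zero → refl }
    ; reach  = λ _ → [] , refl
    ; apart  = λ { Fin.zero Fin.zero _ → refl }
    ; source = Fin.zero , Merge-refl _
    }

  -- `L` lists the orbits that may still be uncovered. A missing orbit lies in `L` and leaves it on
  -- becoming a representative, so the length bounds the number of rounds.
  saturateReps : ∀ k (L : List Orb) → length L ≡ k → (V : Representatives) → (∀ o → o ∈ L ⊎ Covered V o) → Σ Representatives Closed
  saturateReps k L len V cover = decide (missing? V)
    where
    decide : Dec (Missing V) → Σ Representatives Closed
    decide (no none) = V , closed V none
    decide (yes (i , j , o , e , ¬c)) = [ (λ o∈L → grow k L len cover o∈L) , (λ c → contradiction c ¬c) ]′ (cover o)
      where
      V′ = extendReps V o (reach-edge V i j o e) ¬c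
      grow : ∀ k L → length L ≡ k → (∀ o → o ∈ L ⊎ Covered V o) → o ∈ L → Σ Representatives Closed
      grow zero    (_ ∷ _) () cover o∈L
      grow (suc k) L len cover o∈L = saturateReps k L′ (ℕₚ.suc-injective (trans (sym len′) len)) V′ cover′
        where
        L′ = proj₁ (remove o∈L)
        len′ = proj₁ (proj₂ (remove o∈L))
        split = proj₂ (proj₂ (remove o∈L))
        cover′ : ∀ o → o ∈ L′ ⊎ Covered V′ o
        cover′ o′ = [ (λ o′∈L → [ (λ { refl → inj₂ (Fin.zero , Merge-refl o′) }) , inj₁ ]′ (split o′∈L)) ,
                      (λ (l , m) → inj₂ (Fin.suc l , m)) ]′ (cover o′)

  closedReps : Σ Representatives Closed
  closedReps = saturateReps _ (allFin _) refl initialReps (inj₁ ∘ ∈-allFin)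

  ~D : ∀ {n f g} o l → Dec (Merge o l) → TDfn n f → TDfn n g → Dfn n (λ ρ → pt o (f ρ) ~ pt l (g ρ))
  ~D {f = f} {g} o l (yes (z , e)) s t = mapD (λ ρ → to (f ρ) (g ρ) , from (f ρ) (g ρ)) (divD (μ l) (t -T (conT z +T s)))
    where
    to : ∀ x y → + μ l ∣ y ℤ.- (z ℤ.+ x) → pt o x ~ pt l y
    to x y d = ~-trans (~-pt e x) (~-sym (Per⇒pt~ (proj₂ (proj₂ (generator l) _) d)))
    from : ∀ x y → pt o x ~ pt l y → + μ l ∣ y ℤ.- (z ℤ.+ x)
    from x y e′ = proj₁ (proj₂ (generator l) _) (pt~⇒Per (~-trans (~-sym e′) (~-pt e x)))
  ~D {f = f} {g} o l (no ¬m) s t = mapD (λ ρ → ⊥-elim , λ e → ¬m (_ , ~-at-0 e)) (constD (no id))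

  module Minimal (V : Representatives) (isClosed : Closed V) where
    module Q = Points (chars V)

    -- The chosen orbit of `D` may have more points than its quotient, so `lift` commutes with
    -- translations only up to `~`.
    lift : Elt (chars V) → State D
    lift q = pt (orb V (orbit (chars V) q)) (repE (chars V) q)

    Step : L.Orb → Fin (length (chars V)) → Fin (length (chars V)) → Env 3 → Set
    Step j i l ρ = Σ (State D) λ r → Δ D (pt (orb V i) (ρ Fin.zero)) (L.pt j (ρ (Fin.suc Fin.zero))) r
                                   × r ~ pt (orb V l) (ρ (Fin.suc (Fin.suc Fin.zero)))

    stepD : ∀ j i l → Dfn 3 (Step j i l)
    stepD j i l = ∃EltD states λ o →
      ΔD (orb V i) j o (varT (Fin.suc Fin.zero)) (varT (Fin.suc (Fin.suc Fin.zero))) (varT Fin.zero)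
        ×D ~D o (orb V l) (merge? o (orb V l)) (varT Fin.zero) (varT (Fin.suc (Fin.suc (Fin.suc Fin.zero))))

    -- Type checking is kept from unfolding the large eliminated formulas.
    abstract
      stepφ : L.Orb → Fin (length (chars V)) → Fin (length (chars V)) → Formula 3
      stepφ j i l = formulaOf (stepD j i l)

      stepφ-correct : ∀ j i l ρ → ⟦ stepφ j i l ⟧ ρ ⟺ Step j i l ρ
      stepφ-correct j i l ρ = formulaOf-correct (stepD j i l) ρ

    i₀ = proj₁ (source V)
    z₀ = proj₁ (proj₂ (source V))

    quotient-automaton : Desc A
    quotient-automaton = record
      { states = chars V
      ; trans  = λ i j l → stepφ j i l
      ; init   = Q.pt i₀ (z₀ ℤ.+ repE states init)
      ; final  = final ∘ orb V
      }

    private D′ = quotient-automaton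

    Δ′-spec : ∀ q a q′ → Δ D′ q a q′ ⟺ (δ (lift q) a ~ lift q′)
    Δ′-spec q a q′ = ⟺-trans (stepφ-correct (orbit A a) (orbit (chars V) q) (orbit (chars V) q′) ρ)
      ((λ (r , t , e) → ~-trans (~-reflexive (δ-unique (subst (λ a → Δ D (lift q) a r) (L.pt-rep a) t))) e) ,
       (λ e → δ (lift q) a , subst (λ b → Δ D (lift q) b (δ (lift q) a)) (sym (L.pt-rep a)) (δ-Δ (lift q) a) , e))
      where
      ρ = env3 (repE (chars V) q) (repE A a) (repE (chars V) q′)

    lift-pt : ∀ i s → lift (Q.pt i s) ~ pt (orb V i) s
    lift-pt i s = Per⇒pt~ (proj₂ (proj₂ (generator (orb V i)) _)
      (subst (λ m → + m ∣ repE (chars V) (Q.pt i s) ℤ.- s) (char V i) (∣-flip s _ (rep-ι (lookup (chars V) i) s))))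

    lift-injective : ∀ q q′ → lift q ~ lift q′ → q ≡ q′
    lift-injective q@(i , x) q′@(j , y) e = go (apart V i j (_ , ~-at-0 e)) e
      where
      go : i ≡ j → lift (i , x) ~ lift (j , y) → (i , x) ≡ (j , y)
      go refl e = trans (sym (Q.pt-rep (i , x))) (trans (Q.pt-cong i _ _
        (subst (λ m → + m ∣ repE (chars V) (i , x) ℤ.- repE (chars V) (i , y)) (sym (char V i))
          (proj₁ (proj₂ (generator (orb V i)) _) (pt~⇒Per e)))) (Q.pt-rep (i , y)))

    lift-· : ∀ z q → lift (actE (chars V) z q) ~ lift q · z
    lift-· z q = ~-trans (~-reflexive (cong lift (Q.actE-rep z q))) (~-trans (lift-pt _ _) (~-reflexive (sym (actE-pt z _ _))))

    lift-init : lift (Desc.init D′) ~ init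
    lift-init = ~-trans (lift-pt _ _) (~-trans (~-sym (~-pt (proj₂ (proj₂ (source V))) (repE states init))) (~-reflexive (pt-rep init)))

    isDFA′ : IsEquivariantDFA D′
    isDFA′ = record { total = total′ ; functional = functional′ ; δ-equiv = δ-equiv′ ; init-equiv = init-equiv′ }
      where
      total′ : ∀ q a → Σ (State D′) λ q′ → Δ D′ q a q′
      total′ q a = let r = δ (lift q) a
                       l , z , e = isClosed (orbit (chars V) q) a (lift q) refl
                   in Q.pt l (z ℤ.+ repE states r) , proj₂ (Δ′-spec q a _)
                        (~-trans (~-reflexive (sym (pt-rep r))) (~-trans (~-pt e (repE states r)) (~-sym (lift-pt _ _))))
      functional′ : ∀ q a q′ q″ → Δ D′ q a q′ → Δ D′ q a q″ → q′ ≡ q″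
      functional′ q a q′ q″ t t′ = lift-injective q′ q″ (~-trans (~-sym (proj₁ (Δ′-spec q a q′) t)) (proj₁ (Δ′-spec q a q″) t′))
      δ-equiv′ : ∀ (z : ℤ) q a q′ → Δ D′ q a q′ → Δ D′ (actE (chars V) z q) (actE A z a) (actE (chars V) z q′)
      δ-equiv′ z q a q′ t = proj₂ (Δ′-spec _ _ _) (~-trans (~-δ (lift-· z q) (actE A z a))
        (~-trans (~-reflexive (δ-· (lift q) a z)) (~-trans (~-· (proj₁ (Δ′-spec q a q′) t) z) (~-sym (lift-· z q′)))))
      init-equiv′ : ∀ (z : ℤ) → actE (chars V) z (Desc.init D′) ≡ Desc.init D′
      init-equiv′ z = lift-injective _ _ (~-trans (lift-· z _) (~-trans (~-· lift-init z)
        (~-trans (~-reflexive (init-equiv z)) (~-sym lift-init))))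

    private module M = Automaton D′ isDFA′

    accepts-lift : ∀ q w → M.accepts q w ≡ accepts (lift q) w
    accepts-lift q []      = refl
    accepts-lift q (a ∷ w) = trans (accepts-lift (M.δ q a) w) (sym (on (proj₁ (Δ′-spec q a (M.δ q a)) (M.δ-Δ q a)) w))

    accepts-init : ∀ w → M.accepts (Desc.init D′) w ≡ accepts init w
    accepts-init w = trans (accepts-lift _ w) (on lift-init w)

    same-language : ∀ w → Lang D w ⟺ Lang D′ w
    same-language w = ⟺-trans (LangFrom-accepts init w) (⟺-trans (≡⇒true-⟺ (sym (accepts-init w))) (⟺-sym (M.LangFrom-accepts _ w)))

    residual : ∀ q u → (∀ v → M.accepts q v ≡ M.accepts (Desc.init D′) (u ++ v)) → ∀ v → LangFrom D′ q v ⟺ Residual D′ u v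
    residual q u e v = ⟺-trans (M.LangFrom-accepts q v) (⟺-trans (≡⇒true-⟺ (e v)) (⟺-sym (M.LangFrom-accepts _ (u ++ v))))

    isMinimal : IsMinimal D′
    isMinimal = record { into = into ; onto = onto ; inj = injective }
      where
      into : ∀ q → Σ (Word D′) λ u → ∀ v → LangFrom D′ q v ⟺ Residual D′ u v
      into q = w , residual q w λ v → trans (accepts-lift q v) (sym (trans (accepts-init (w ++ v))
                 (cong acc (trans (run-++ init w v) (cong (λ r → run r v) run-w)))))
        where
        u = proj₁ (reach V (orbit (chars V) q))
        r = run init u
        t = repE (chars V) q ℤ.- repE states r
        -- The word `u` only reaches the right orbit. As `init` is fixed by all translations,
        -- translating `u` by `t` translates the state reached, and `t` is chosen to make it
        -- `lift q`.
        w = List.map (actE A t) u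
        lem : ∀ a b → b ℤ.+ (a ℤ.- b) ≡ a
        lem = solve-∀
        run-w : run init w ≡ lift q
        run-w = trans (cong (λ q → run q w) (sym (init-equiv t))) (trans (run-· init u t) (trans (actE-rep t r)
                  (cong₂ pt (proj₂ (reach V (orbit (chars V) q))) (lem (repE (chars V) q) (repE states r)))))
      onto : ∀ u → Σ (State D′) λ q → ∀ v → LangFrom D′ q v ⟺ Residual D′ u v
      onto u = M.run (Desc.init D′) u , residual _ u λ v → cong M.acc (sym (M.run-++ (Desc.init D′) u v))
      injective : ∀ q q′ → (∀ v → LangFrom D′ q v ⟺ LangFrom D′ q′ v) → q ≡ q′
      injective q q′ e = lift-injective q q′ (mk~ λ v → trans (sym (accepts-lift q v)) (trans (true-⟺⇒≡
        (⟺-trans (⟺-sym (M.LangFrom-accepts q v)) (⟺-trans (e v) (M.LangFrom-accepts q′ v)))) (accepts-lift q′ v)))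

-- The minimisation algorithm

Minimisation : ∀ {A} → Desc A → Desc A → Set
Minimisation D D′ = IsEquivariantDFA D′ × ((∀ w → (Lang D w → Lang D′ w) × (Lang D′ w → Lang D w)) × IsMinimal D′)

minimal : ∀ {A} (D : Desc A) → IsEquivariantDFA D → Σ (Desc A) (Minimisation D)
minimal D isDFA = quotient-automaton , isDFA′ , same-language , isMinimal
  where
  open PeriodBound D isDFA
  open Equivalence D isDFA C period≤C
  open Quotient D isDFA generator merge?
  open Minimal (proj₁ closedReps) (proj₂ closedReps)

theorem6 : Σ ((A : List ℕ) → Desc A → Desc A) λ minimise → ∀ (A : List ℕ) (D : Desc A) → IsEquivariantDFA D → IsEquivariantDFA (minimise A D) × ((∀ w → (Lang D w → Lang (minimise A D) w) × (Lang (minimise A D) w → Lang D w)) × IsMinimal (minimise A D))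
theorem6 = (λ A D → choose D (isDFA? D)) , λ A D isDFA → correct D isDFA (isDFA? D)
  where
  open Definability using (isDFA?)
  choose : ∀ {A} (D : Desc A) → Dec (IsEquivariantDFA D) → Desc A
  choose D (yes isDFA) = proj₁ (minimal D isDFA)
  -- A default for descriptions that are not equivariant automata, about which nothing is claimed.
  choose D (no _)      = D
  correct : ∀ {A} (D : Desc A) → IsEquivariantDFA D → ∀ d → Minimisation D (choose D d)
  correct D _     (yes isDFA) = proj₂ (minimal D isDFA)
  correct D isDFA (no ¬dfa)   = contradiction isDFA ¬dfa
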